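{- Let $u$ and $v$ be any two $\mathbf{c}\mathbf{d}$-monomials (words in the non-commuting letters $\mathbf{c},\mathbf{d}$, possibly the empty word $1$). Then the $\mathbf{c}\mathbf{d}$-polynomial $u\diamond v$ is given by $$u\diamond v=\sum_{P\in \Gamma(u,v)} \operatorname{wt}_{u,v}(P),$$ where $\diamond$ is the diamond product on $\mathbb{Z}\langle\mathbf{c},\mathbf{d}\rangle$, $\Gamma(u,v)$ is the set of admissible lattice paths associated with $u$ and $v$, and $\operatorname{wt}_{u,v}$ is the associated weight function.
   Context: **Ring, coproduct, derivation.** $\mathbb{Z}\langle\mathbf{c},\mathbf{d}\rangle$ is the ring of polynomials in non-commuting variables $\mathbf{c}$ (degree $1$) and $\mathbf{d}$ (degree $2$); it may be regarded as the subring of $\mathbb{Z}\langle\mathbf{a},\mathbf{b}\rangle$ generated by $\mathbf{c}=\mathbf{a}+\mathbf{b}$ and $\mathbf{d}=\mathbf{a}\mathbf{b}+\mathbf{b}\mathbf{a}$. The coproduct $\Delta:\mathbb{Z}\langle\mathbf{c},\mathbf{d}\rangle\to\mathbb{Z}\langle\mathbf{c},\mathbf{d}\rangle\otimes\mathbb{Z}\langle\mathbf{c},\mathbf{d}\rangle$, written $\Delta(u)=\sum_u u_{(1)}\otimes u_{(2)}$ in Sweedler notation, is the linear map determined by $\Delta(1)=0$, $\Delta(\mathbf{c})=2\cdot 1\otimes 1$, $\Delta(\mathbf{d})=1\otimes\mathbf{c}+\mathbf{c}\otimes 1$ and $$\Delta(u\cdot v)=\sum_u u_{(1)}\otimes u_{(2)}\cdot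 v+\sum_v u\cdot v_{(1)}\otimes v_{(2)}.$$ $G$ is the derivation on $\mathbb{Z}\langle\mathbf{c},\mathbf{d}\rangle$ (linear, $G(uv)=G(u)v+uG(v)$) with $G(\mathbf{c})=\mathbf{d}$ and $G(\mathbf{d})=\mathbf{c}\cdot\mathbf{d}$, and $\operatorname{Pyr}(u)=u\cdot\mathbf{c}+G(u)$. **Diamond product.** $\diamond:\mathbb{Z}\langle\mathbf{c},\mathbf{d}\rangle\times\mathbb{Z}\langle\mathbf{c},\mathbf{d}\rangle\to\mathbb{Z}\langle\mathbf{c},\mathbf{d}\rangle$ is the bilinear operator (determined uniquely) satisfying, for all $\mathbf{c}\mathbf{d}$-polynomials $u,v$, $$u\diamond 1=u,$$ $$u\diamond (v\cdot \mathbf{c}) =(u\diamond v)\cdot \mathbf{c} + \sum_u (u_{(1)} \diamond v)\cdot \mathbf{d} \cdot u_{(2)},$$ $$u\diamond (v\cdot \mathbf{d}) = (u\diamond v)\cdot \mathbf{d} + \sum_u (u_{(1)} \diamond v)\cdot \mathbf{d} \cdot \operatorname{Pyr}(u_{(2)}).$$ **Lattice paths.** Lattice paths are words in the letters $\mathbf{R}=(1,0)$, $\mathbf{U}=(0,1)$, $\mathbf{D}=(1,1)$, $\overline{\mathbf{R}}=(2,0)$ (double right), $\overline{\mathbf{U}}=(0,2)$ (double up), read as successive steps starting at the origin. $\Gamma(p,q)$ is the set of all such paths from $(0,0)$ to $(p,q)$ that do not contain any of $\mathbf{U}\mathbf{R}$, $\mathbf{U}\overline{\mathbf{R}}$, $\overline{\mathbf{U}}\mathbf{R}$,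 $\overline{\mathbf{U}}\,\overline{\mathbf{R}}$ as consecutive steps. **Labels.** Let $u,v$ have degrees $p,q$. Label the horizontal axis from $0$ to $p$ by the letters of $u$ in order from left to right, and the vertical axis from $0$ to $q$ by the letters of $v$ in order from bottom to top, where a $\mathbf{c}$ label covers one unit and a $\mathbf{d}$ label covers two units. The two units of a horizontal $\mathbf{d}$ label are its first part (left) and second part (right); the two units of a vertical $\mathbf{d}$ label are its bottom (half) and top (half). A step is "above" the part of the horizontal axis over which its $x$-coordinate moves, and "to the right of" the part of the vertical axis over which its $y$-coordinate moves. **The set $\Gamma(u,v)$.** It consists of the paths in $\Gamma(p,q)$ satisfying: 1. No $\mathbf{U}$ step is to the right of the bottom of a $\mathbf{d}$ label on the vertical axis. 2. An $\mathbf{R}$ step is allowed above the first part of a $\mathbf{d}$ label on the horizontal axis, but two consecutive $\mathbf{R}$ steps above the (first and second parts of the) same $\mathbf{d}$ label are not allowed. 3. A $\overline{\mathbf{U}}$ step is allowed only when it starts at the bottom of a $\mathbf{d}$ label on the vertical axis (so that it exactly spans that label), and an $\overline{\mathbf{R}}$ step is allowed only when it starts at the left end of a $\mathbf{d}$ label on the horizontal axis (so that it exactly spans that label). 4. If a $\mathbf{D}$ step of the path is to the right of the bottom of a $\mathbf{d}$ label on the vertical axis, then the path may not contain consecutive steps $\mathbf{D}\mathbf{R}$ above a single $\mathbf{d}$ label on the horizontal axis ($\mathbf{D}$ above its first part, $\mathbf{R}$ above its second part) in which this $\mathbf{D}$ is to the right of the top half of that same vertical $\mathbf{d}$ label. **The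 weight.** For $P\in\Gamma(u,v)$, $\operatorname{wt}_{u,v}(P)\in\mathbb{Z}\langle\mathbf{c},\mathbf{d}\rangle$ is the product, in order along the path, of the weights of its steps: $\mathbf{R}$ and $\mathbf{U}$ steps have weight $\mathbf{c}$; $\overline{\mathbf{R}}$ and $\overline{\mathbf{U}}$ steps have weight $\mathbf{d}$; a $\mathbf{D}$ step has weight $k\mathbf{d}$, where - $k=2$ if the $\mathbf{D}$ step is above a $\mathbf{c}$ label and to the right of either a $\mathbf{c}$ label or the bottom of a $\mathbf{d}$ label; - $k=2$ if it is above the first part of a $\mathbf{d}$ label, to the right of a $\mathbf{c}$ label, and (immediately) followed by a $\mathbf{U}$, $\overline{\mathbf{U}}$ or $\mathbf{D}$ step; - $k=2$ if it is above the first part of a $\mathbf{d}$ label, to the right of the bottom of a $\mathbf{d}$ label, and (immediately) followed by a $\mathbf{U}$ step; - $k=1$ otherwise. -}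

module Defs where

open import Data.Bool.Base using (if_then_else_)
open import Data.Integer.Base as ℤ using (ℤ; 0ℤ; 1ℤ)
open import Data.List.Base using (List; []; _∷_; _++_; [_]; _∷ʳ_; concat; concatMap; head; map; reverse)
open import Data.List.Properties using (≡-dec; reverse-++; map-++; map-id; map-∘; map-cong; ++-assoc)
open import Data.List.Relation.Unary.Linked using (Linked)
open import Data.Maybe.Base using (Maybe; just; nothing)
open import Data.Nat.Base using (ℕ; zero; suc; _+_)
open import Data.Nat.ListAction using (sum)
open import Data.Product.Base using (_×_; _,_; map₂)
open import Relation.Binary.Definitions using (DecidableEquality)
open import Relation.Binary.PropositionalEquality using (_≡_; _≢_; refl; sym; trans; cong; cong₂; module ≡-Reasoning)
open import Relation.Nullary.Decidable.Core using (yes; no; does)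
open import Relation.Nullary.Negation.Core using (¬_)

data Letter : Set where
  𝐜 𝐝 : Letter

_≟ᴸ_ : DecidableEquality Letter
𝐜 ≟ᴸ 𝐜 = yes refl
𝐜 ≟ᴸ 𝐝 = no λ ()
𝐝 ≟ᴸ 𝐜 = no λ ()
𝐝 ≟ᴸ 𝐝 = yes refl

Word : Set
Word = List Letter

_≟ᵂ_ : DecidableEquality Word
_≟ᵂ_ = ≡-dec _≟ᴸ_

deg : Word → ℕ
deg []      = 0
deg (𝐜 ∷ w) = 1 + deg w
deg (𝐝 ∷ w) = 2 + deg w

-- Formal ℤ-linear combinations of elements of X. Terms may repeat and
-- coefficients may vanish; two combinations represent the same element of the
-- free ℤ-module when all their total coefficients agree (see _≈_ below).
Free : Set → Set
Free X = List (ℤ × X)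

η : {X : Set} → X → Free X
η x = [ 1ℤ , x ]

infixr 8 _·_
_·_ : {X : Set} → ℤ → Free X → Free X
k · p = map (λ (j , x) → k ℤ.* j , x) p

infixl 6 _⊕_
_⊕_ : {X : Set} → Free X → Free X → Free X
_⊕_ = _++_

-- The linear extension of a map defined on the basis.
extend : {X Y : Set} → (X → Free Y) → Free X → Free Y
extend f = concatMap (λ (k , x) → k · f x)

-- ℤ⟨𝐜,𝐝⟩ and its tensor square, the latter on the basis of pairs of monomials.
Poly : Set
Poly = Free Word

Tensor : Set
Tensor = Free (Word × Word)

coeff : Word → Poly → ℤ
coeff w []            = 0ℤ
coeff w ((k , x) ∷ p) = (if does (x ≟ᵂ w) then k else 0ℤ) ℤ.+ coeff w p

infix 4 _≈_
_≈_ : Poly → Poly → Set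
p ≈ q = ∀ w → coeff w p ≡ coeff w q

infixl 7 _*_
_*_ : Poly → Poly → Poly
p * q = extend (λ a → extend (λ b → η (a ++ b)) q) p

one : Poly
one = η []

letter : Letter → Poly
letter x = η [ x ]

-- Multiplication of an element of a bimodule by a monomial, on basis elements.
infixr 7 _◃_
_◃_ : Word → Poly → Poly
u ◃ p = map (map₂ (λ a → u ++ a)) p

infixl 7 _▹_
_▹_ : Poly → Word → Poly
p ▹ v = map (map₂ (λ a → a ++ v)) p

infixr 7 _◃⊗_
_◃⊗_ : Word → Tensor → Tensor
u ◃⊗ t = map (map₂ (λ (a , b) → u ++ a , b)) t

infixl 7 _⊗▹_
_⊗▹_ : Tensor → Word → Tensor
t ⊗▹ v = map (map₂ (λ (a , b) → a , b ++ v)) t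

Δᴸ : Letter → Tensor
Δᴸ 𝐜 = [ ℤ.+ 2 , [] , [] ]
Δᴸ 𝐝 = η ([] , [ 𝐜 ]) ⊕ η ([ 𝐜 ] , [])

-- The product rule is used with a single letter as left factor; Δᵂ-++ gives the
-- rule for arbitrary factorisations.
Δᵂ : Word → Tensor
Δᵂ []      = []
Δᵂ (x ∷ w) = Δᴸ x ⊗▹ w ⊕ [ x ] ◃⊗ Δᵂ w

Δ : Poly → Tensor
Δ = extend Δᵂ

Gᴸ : Letter → Poly
Gᴸ 𝐜 = η [ 𝐝 ]
Gᴸ 𝐝 = η (𝐜 ∷ 𝐝 ∷ [])

Gᵂ : Word → Poly
Gᵂ []      = []
Gᵂ (x ∷ w) = Gᴸ x ▹ w ⊕ [ x ] ◃ Gᵂ w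

G : Poly → Poly
G = extend Gᵂ

Pyr : Poly → Poly
Pyr u = u * letter 𝐜 ⊕ G u

-- dia u v is u ⋄ (reverse v): the recursion peels off the last letter of the
-- right-hand argument of ⋄.
dia : Word → Word → Poly
dia u []      = η u
dia u (𝐜 ∷ v) = dia u v * letter 𝐜 ⊕ extend (λ (a , b) → dia a v * letter 𝐝 * η b) (Δᵂ u)
dia u (𝐝 ∷ v) = dia u v * letter 𝐝 ⊕ extend (λ (a , b) → dia a v * letter 𝐝 * Pyr (η b)) (Δᵂ u)

_⋄ᵂ_ : Word → Word → Poly
u ⋄ᵂ v = dia u (reverse v)

infixl 7 _⋄_
_⋄_ : Poly → Poly → Poly
p ⋄ q = extend (λ u → extend (λ v → u ⋄ᵂ v) q) p

private
  step : {A : Set} (xs ys zs : List A) {α β γ δ : A → A} {d : List A} →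
         (∀ a → β (α a) ≡ α (β a)) → (∀ a → α (γ a) ≡ δ a) → d ≡ map β xs →
         d ++ map α (map β ys ++ map γ zs) ≡ map β (xs ++ map α ys) ++ map δ zs
  step xs ys zs {α} {β} {γ} {δ} {d} βα αγ refl = begin
    map β xs ++ map α (map β ys ++ map γ zs)
      ≡⟨ cong (map β xs ++_) (map-++ α (map β ys) (map γ zs)) ⟩
    map β xs ++ map α (map β ys) ++ map α (map γ zs)
      ≡⟨ cong (map β xs ++_) (cong₂ _++_
           (trans (sym (map-∘ ys)) (trans (map-cong (λ a → sym (βα a)) ys) (map-∘ ys)))
           (trans (sym (map-∘ zs)) (map-cong αγ zs))) ⟩
    map β xs ++ map β (map α ys) ++ map δ zs
      ≡⟨ ++-assoc (map β xs) _ _ ⟨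
    (map β xs ++ map β (map α ys)) ++ map δ zs
      ≡⟨ cong (_++ map δ zs) (map-++ β xs (map α ys)) ⟨
    map β (xs ++ map α ys) ++ map δ zs ∎
    where open ≡-Reasoning

Δᵂ-++ : ∀ u v → Δᵂ (u ++ v) ≡ Δᵂ u ⊗▹ v ⊕ u ◃⊗ Δᵂ v
Δᵂ-++ []      v = sym (map-id (Δᵂ v))
Δᵂ-++ (x ∷ u) v = trans
  (cong (λ t → Δᴸ x ⊗▹ (u ++ v) ⊕ [ x ] ◃⊗ t) (Δᵂ-++ u v))
  (step (Δᴸ x ⊗▹ u) (Δᵂ u) (Δᵂ v) (λ _ → refl) (λ _ → refl) (base x))
  where
  base : ∀ x → Δᴸ x ⊗▹ (u ++ v) ≡ Δᴸ x ⊗▹ u ⊗▹ v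
  base 𝐜 = refl
  base 𝐝 = refl

Gᵂ-++ : ∀ u v → Gᵂ (u ++ v) ≡ Gᵂ u ▹ v ⊕ u ◃ Gᵂ v
Gᵂ-++ []      v = sym (map-id (Gᵂ v))
Gᵂ-++ (x ∷ u) v = trans
  (cong (λ p → Gᴸ x ▹ (u ++ v) ⊕ [ x ] ◃ p) (Gᵂ-++ u v))
  (step (Gᴸ x ▹ u) (Gᵂ u) (Gᵂ v) (λ _ → refl) (λ _ → refl) (base x))
  where
  base : ∀ x → Gᴸ x ▹ (u ++ v) ≡ Gᴸ x ▹ u ▹ v
  base 𝐜 = refl
  base 𝐝 = refl

⋄ᵂ-𝟏 : ∀ u → u ⋄ᵂ [] ≡ η u
⋄ᵂ-𝟏 u = refl

⋄ᵂ-𝐜 : ∀ u v → u ⋄ᵂ (v ∷ʳ 𝐜) ≡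
       (u ⋄ᵂ v) * letter 𝐜 ⊕ extend (λ (a , b) → (a ⋄ᵂ v) * letter 𝐝 * η b) (Δᵂ u)
⋄ᵂ-𝐜 u v = cong (dia u) (reverse-++ v [ 𝐜 ])

⋄ᵂ-𝐝 : ∀ u v → u ⋄ᵂ (v ∷ʳ 𝐝) ≡
       (u ⋄ᵂ v) * letter 𝐝 ⊕ extend (λ (a , b) → (a ⋄ᵂ v) * letter 𝐝 * Pyr (η b)) (Δᵂ u)
⋄ᵂ-𝐝 u v = cong (dia u) (reverse-++ v [ 𝐝 ])

-- R₂ and U₂ are the double right and double up steps.
data Step : Set where
  R U D R₂ U₂ : Step

Path : Set
Path = List Step

Δx Δy : Step → ℕ
Δx R  = 1
Δx U  = 0
Δx D  = 1
Δx R₂ = 2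
Δx U₂ = 0

Δy R  = 0
Δy U  = 1
Δy D  = 1
Δy R₂ = 0
Δy U₂ = 2

endX endY : Path → ℕ
endX P = sum (map Δx P)
endY P = sum (map Δy P)

data Upward : Step → Set where
  U  : Upward U
  U₂ : Upward U₂

data Rightward : Step → Set where
  R  : Rightward R
  R₂ : Rightward R₂

record Γ₀ (p q : ℕ) (P : Path) : Set where
  field
    endX≡p     : endX P ≡ p
    endY≡q     : endY P ≡ q
    noUpRight  : Linked (λ s t → ¬ (Upward s × Rightward t)) P

-- What a unit interval of an axis is labelled by: a 𝐜 label, or the first
-- (left, bottom) or second (right, top) part of a 𝐝 label.
data Part : Set where
  𝐜 𝐝₁ 𝐝₂ : Part

-- part w i is the label of the interval [i , i+1] of an axis labelled by w.
part : Word → ℕ → Maybe Part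
part []      i             = nothing
part (𝐜 ∷ w) zero          = just 𝐜
part (𝐜 ∷ w) (suc i)       = part w i
part (𝐝 ∷ w) zero          = just 𝐝₁
part (𝐝 ∷ w) (suc zero)    = just 𝐝₂
part (𝐝 ∷ w) (suc (suc i)) = part w i

-- In a factorisation P ≡ A ++ s ∷ B the step s starts at (endX A , endY A).
-- The interval [i+1 , i+2] is the second part of the 𝐝 label whose first part
-- is [i , i+1], so only the first part is tested for.
record Γ (u v : Word) (P : Path) : Set where
  field
    lattice  : Γ₀ (deg u) (deg v) P
    U-ok     : ∀ A B → P ≡ A ++ U ∷ B → part v (endY A) ≢ just 𝐝₁
    RR-ok    : ∀ A B → P ≡ A ++ R ∷ R ∷ B → part u (endX A) ≢ just 𝐝₁
    U₂-ok    : ∀ A B → P ≡ A ++ U₂ ∷ B → part v (endY A) ≡ just 𝐝₁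
    R₂-ok    : ∀ A B → P ≡ A ++ R₂ ∷ B → part u (endX A) ≡ just 𝐝₁
    DR-ok    : ∀ A B A′ B′ →
               P ≡ A ++ D ∷ B → part v (endY A) ≡ just 𝐝₁ →
               P ≡ A′ ++ D ∷ R ∷ B′ → endY A′ ≡ suc (endY A) →
               part u (endX A′) ≢ just 𝐝₁

-- The multiplicity k of a D step, given the label below it, the vertical label to its
-- left, and the next step, if any.
multiplicity : Maybe Part → Maybe Part → Maybe Step → ℤ
multiplicity (just 𝐜)  (just 𝐜)  _         = ℤ.+ 2
multiplicity (just 𝐜)  (just 𝐝₁) _         = ℤ.+ 2
multiplicity (just 𝐝₁) (just 𝐜)  (just U)  = ℤ.+ 2
multiplicity (just 𝐝₁) (just 𝐜)  (just U₂) = ℤ.+ 2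
multiplicity (just 𝐝₁) (just 𝐜)  (just D)  = ℤ.+ 2
multiplicity (just 𝐝₁) (just 𝐝₁) (just U)  = ℤ.+ 2
multiplicity _         _         _         = ℤ.+ 1

stepWt : Maybe Part → Maybe Part → Step → Maybe Step → Poly
stepWt h v R  next = letter 𝐜
stepWt h v U  next = letter 𝐜
stepWt h v R₂ next = letter 𝐝
stepWt h v U₂ next = letter 𝐝
stepWt h v D  next = multiplicity h v next · letter 𝐝

-- The weight of a path that starts at (x , y).
wtFrom : Word → Word → ℕ → ℕ → Path → Poly
wtFrom u v x y []      = one
wtFrom u v x y (s ∷ P) =
  stepWt (part u x) (part v y) s (head P) * wtFrom u v (x + Δx s) (y + Δy s) P

wt : Word → Word → Path → Poly
wt u v = wtFrom u v 0 0

∑ : List Poly → Poly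
∑ = concat

{-# OPTIONS --safe #-}

-- The recursion for ⋄ peels the last letter off v, that is, the last row off a path. If the path
-- enters this row by an up step, the step is the last one, as no right step may follow; this is
-- the term (u ⋄ v) · x. Otherwise it enters the row by a D step, which cuts the horizontal axis as
-- a term a ⊗ b of Δ(u): above a 𝐜 label (coefficient 2), above the first part of a 𝐝 label
-- (b starts with the 𝐜 that the second part contributes) or above the second part (a ends with a
-- 𝐜). After this D step only right steps are left in a 𝐜 row, spelling b; in a 𝐝 row there is in
-- addition a final U or one more D, which gives Pyr(b). Before it, the path is a path for a: half
-- a 𝐝 label at the right end acts like a 𝐜 label, in the rules as well as in the weights.
module Submission where

open import Defs
open import Data.Empty using (⊥-elim)
open import Data.Integer.Base as ℤ using (ℤ; 1ℤ)
import Data.Integer.Properties as ℤ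
open import Data.List.Base using (List; []; _∷_; _++_; _∷ʳ_; [_]; concat; concatMap; map; reverse; head)
open import Data.List.Relation.Binary.Disjoint.Propositional using (Disjoint)
open import Data.List.Membership.Propositional using (_∈_; find; lose)
open import Data.List.Membership.Propositional.Properties using (∈-map⁺; ∈-map⁻; ∈-++⁺ˡ; ∈-++⁺ʳ; ∈-concatMap⁺)
open import Data.List.Properties
open import Data.List.Relation.Unary.All using (All; []; _∷_)
import Data.List.Relation.Unary.All as All
import Data.List.Relation.Unary.All.Properties as All
open import Data.List.Relation.Unary.AllPairs using (AllPairs; []; _∷_)
import Data.List.Relation.Unary.AllPairs as AllPairs
import Data.List.Relation.Unary.AllPairs.Properties as AllPairs
open import Data.List.Relation.Unary.Any using (Any; here; there)
import Data.List.Relation.Unary.Any as Any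
import Data.List.Relation.Unary.Any.Properties as Any
open import Data.List.Relation.Unary.Linked using (Linked; []; [-]; _∷_)
import Data.List.Relation.Unary.Linked as Linked
open import Data.List.Relation.Unary.Unique.Propositional using (Unique)
import Data.List.Relation.Unary.Unique.Propositional.Properties as Unique
open import Data.Maybe.Base using (Maybe; just; nothing)
open import Data.Maybe.Properties using (just-injective)
open import Data.Nat.Base using (ℕ; zero; suc; _+_; _≤_; _<_; z≤n; s≤s)
open import Data.Nat.ListAction using (sum)
open import Data.Nat.Properties
open import Data.Product.Base using (_×_; _,_; ∃-syntax; proj₁; proj₂)
open import Data.Sum.Base using (_⊎_; inj₁; inj₂)
open import Data.Unit.Base using (⊤)
open import Function.Base using (_∘_; case_of_)
open import Function.Bundles using (_⇔_; mk⇔)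
open import Relation.Binary.PropositionalEquality
  using (_≡_; _≢_; refl; sym; trans; cong; cong₂; subst; subst₂; module ≡-Reasoning)
open import Relation.Nullary.Negation using (¬_)

private variable
  s t : Step
  n : Maybe Step
  P Q : Path
  i j x y X Y : ℕ

-- Admissibility and multiplicity as local conditions along a path.

Axis : Set
Axis = ℕ → Maybe Part

pos : (Step → ℕ) → Path → ℕ → ℕ
pos δ []      i = i
pos δ (s ∷ P) i = pos δ P (δ s + i)

pos-++ : ∀ δ P Q i → pos δ (P ++ Q) i ≡ pos δ Q (pos δ P i)
pos-++ δ []      Q i = refl
pos-++ δ (s ∷ P) Q i = pos-++ δ P Q (δ s + i)

pos-≤ : ∀ δ P i → i ≤ pos δ P i
pos-≤ δ []      i = ≤-refl
pos-≤ δ (s ∷ P) i = ≤-trans (m≤n+m i (δ s)) (pos-≤ δ P (δ s + i))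

pos-sum : ∀ δ P i → pos δ P i ≡ sum (map δ P) + i
pos-sum δ []      i = refl
pos-sum δ (s ∷ P) i = begin
  pos δ P (δ s + i)           ≡⟨ pos-sum δ P (δ s + i) ⟩
  sum (map δ P) + (δ s + i)   ≡⟨ +-assoc (sum (map δ P)) (δ s) i ⟨
  sum (map δ P) + δ s + i     ≡⟨ cong (_+ i) (+-comm (sum (map δ P)) (δ s)) ⟩
  δ s + sum (map δ P) + i     ∎
  where open ≡-Reasoning

pos-0 : ∀ δ P → pos δ P 0 ≡ sum (map δ P)
pos-0 δ P = trans (pos-sum δ P 0) (+-identityʳ _)

pos-≢ : ∀ δ P → i < j → pos δ P j ≢ i
pos-≢ δ P i<j e = <⇒≢ (≤-trans i<j (pos-≤ δ P _)) (sym e)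

-- The argument `n` stands for the step after the end of the path. With it `Valid` and `mult` split
-- exactly at a concatenation, although both look one step ahead.
nxt : Path → Maybe Step → Maybe Step
nxt []      n = n
nxt (s ∷ P) n = just s

nxt-nothing : ∀ P → nxt P nothing ≡ head P
nxt-nothing []      = refl
nxt-nothing (s ∷ P) = refl

NonRight : Maybe Step → Set
NonRight n = ∀ {s} → n ≡ just s → ¬ Rightward s

-- h and w are the labels below the step and to its left, n is the step that follows.
-- The middle height of a vertical 𝐝 label is only reached by a D step from its bottom,
-- so condition 4 amounts to forbidding DR over a 𝐝 label with this D beside a label 𝐝₂.
Allowed : Maybe Part → Maybe Part → Step → Maybe Step → Set
Allowed h w R  n = n ≡ just R → h ≢ just 𝐝₁
Allowed h w U  n = w ≢ just 𝐝₁ × NonRight n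
Allowed h w D  n = w ≡ just 𝐝₂ → n ≡ just R → h ≢ just 𝐝₁
Allowed h w R₂ n = h ≡ just 𝐝₁
Allowed h w U₂ n = w ≡ just 𝐝₁ × NonRight n

-- P starts at (x , y) and is followed by the step n, if any.
Valid : Axis → Axis → ℕ → ℕ → Path → Maybe Step → Set
Valid h w x y []      n = ⊤
Valid h w x y (s ∷ P) n =
  Allowed (h x) (w y) s (nxt P n) × Valid h w (Δx s + x) (Δy s + y) P n

multStep : Maybe Part → Maybe Part → Step → Maybe Step → ℤ
multStep h w D n = multiplicity h w n
multStep h w _ n = 1ℤ

mult : Axis → Axis → ℕ → ℕ → Path → Maybe Step → ℤ
mult h w x y []      n = 1ℤ
mult h w x y (s ∷ P) n =
  multStep (h x) (w y) s (nxt P n) ℤ.* mult h w (Δx s + x) (Δy s + y) P n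

nxt-++ : ∀ P Q n → nxt (P ++ Q) n ≡ nxt P (nxt Q n)
nxt-++ []      Q n = refl
nxt-++ (s ∷ P) Q n = refl

module _ {h w : Axis} where

  Valid-++⁺ : ∀ P Q → Valid h w x y P (nxt Q n) →
              Valid h w (pos Δx P x) (pos Δy P y) Q n → Valid h w x y (P ++ Q) n
  Valid-++⁺             []      Q vP       vQ = vQ
  Valid-++⁺ {n = n} (s ∷ P) Q (a , vP) vQ =
    subst (Allowed _ _ s) (sym (nxt-++ P Q n)) a , Valid-++⁺ P Q vP vQ

  Valid-++⁻ : ∀ P Q → Valid h w x y (P ++ Q) n →
              Valid h w x y P (nxt Q n) × Valid h w (pos Δx P x) (pos Δy P y) Q n
  Valid-++⁻             []      Q v       = _ , v
  Valid-++⁻ {n = n} (s ∷ P) Q (a , v) with vP , vQ ← Valid-++⁻ P Q v =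
    (subst (Allowed _ _ s) (nxt-++ P Q n) a , vP) , vQ

  mult-++ : ∀ P Q → mult h w x y (P ++ Q) n ≡
            mult h w x y P (nxt Q n) ℤ.* mult h w (pos Δx P x) (pos Δy P y) Q n
  mult-++ []      Q = sym (ℤ.*-identityˡ _)
  mult-++ {n = n} (s ∷ P) Q = begin
    multStep _ _ s (nxt (P ++ Q) n) ℤ.* mult h w _ _ (P ++ Q) n
      ≡⟨ cong₂ ℤ._*_ (cong (multStep _ _ s) (nxt-++ P Q n)) (mult-++ P Q) ⟩
    multStep _ _ s (nxt P (nxt Q n)) ℤ.* (mult h w _ _ P _ ℤ.* mult h w _ _ Q n)
      ≡⟨ ℤ.*-assoc (multStep _ _ s (nxt P (nxt Q n))) _ _ ⟨
    multStep _ _ s (nxt P (nxt Q n)) ℤ.* mult h w _ _ P _ ℤ.* mult h w _ _ Q n ∎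
    where open ≡-Reasoning

-- Weights of paths as single terms.

weightLetter : Step → Letter
weightLetter R  = 𝐜
weightLetter U  = 𝐜
weightLetter D  = 𝐝
weightLetter R₂ = 𝐝
weightLetter U₂ = 𝐝

stepWt-monomial : ∀ h w s n → stepWt h w s n ≡ [ multStep h w s n , [ weightLetter s ] ]
stepWt-monomial h w R  n = refl
stepWt-monomial h w U  n = refl
stepWt-monomial h w D  n = cong (λ k → [ k , _ ]) (ℤ.*-identityʳ (multiplicity h w n))
stepWt-monomial h w R₂ n = refl
stepWt-monomial h w U₂ n = refl

-- Each step weight is an integer times one letter, so no sums arise within a path, and coefficients
-- and words can be compared path by path.
wtFrom-monomial : ∀ u v x y P →
  wtFrom u v x y P ≡ [ mult (part u) (part v) x y P nothing , map weightLetter P ]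
wtFrom-monomial u v x y []      = refl
wtFrom-monomial u v x y (s ∷ P)
  -- `wtFrom` adds the increments on the right, `mult` on the left.
  rewrite +-comm x (Δx s) | +-comm y (Δy s) | wtFrom-monomial u v (Δx s + x) (Δy s + y) P
        | nxt-nothing P | stepWt-monomial (part u x) (part v y) s (head P)
  = cong (λ k → [ multStep (part u x) (part v y) s (head P) ℤ.* k , _ ]) (ℤ.*-identityʳ _)

-- Crossing a given height, and labels of neighbouring units.

data Rising : Step → Set where
  U  : Rising U
  D  : Rising D
  U₂ : Rising U₂

-- `U` and `D` climb only one unit. A `U₂` could jump over `Y` only from the unit just below it, but
-- it has to start at a label `𝐝₁`, which `below` excludes there.
crossing : ∀ {w : Axis} P →
  (∀ A B → P ≡ A ++ U₂ ∷ B → w (pos Δy A y) ≡ just 𝐝₁) →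
  (∀ {i} → suc i ≡ Y → w i ≢ just 𝐝₁) →
  y ≤ Y → Y < pos Δy P y →
  ∃[ A ] ∃[ s ] ∃[ B ] P ≡ A ++ s ∷ B × pos Δy A y ≡ Y × Rising s
crossing {y = y} {Y} [] u₂ below y≤Y Y<y = ⊥-elim (<⇒≱ Y<y y≤Y)
crossing {y = y} {Y} {w} (s ∷ P) u₂ below y≤Y Y<end = go s refl (m≤n⇒m<n∨m≡n y≤Y)
  where
  Result = ∃[ A ] ∃[ t ] ∃[ B ] s ∷ P ≡ A ++ t ∷ B × pos Δy A y ≡ Y × Rising t
  later : Δy s + y ≤ Y → Result
  later le with A , t , B , refl , e , r ←
    crossing P (λ A B e → u₂ (s ∷ A) B (cong (s ∷_) e)) below le Y<end = s ∷ A , t , B , refl , e , r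
  go : ∀ t → s ≡ t → (y < Y) ⊎ (y ≡ Y) → Result
  go R  refl _        = later y≤Y
  go R₂ refl _        = later y≤Y
  go U  refl (inj₁ l) = later l
  go D  refl (inj₁ l) = later l
  go U₂ refl (inj₁ l) with m≤n⇒m<n∨m≡n l
  ... | inj₁ l′ = later l′
  ... | inj₂ e  = ⊥-elim (below e (u₂ [] P refl))
  go U  refl (inj₂ e) = [] , U , P , refl , e , U
  go D  refl (inj₂ e) = [] , D , P , refl , e , D
  go U₂ refl (inj₂ e) = [] , U₂ , P , refl , e , U₂

-- The end of an axis never cuts a `𝐝` label: its first part is followed by its second.
part-last : ∀ a → suc i ≡ deg a → part a i ≢ just 𝐝₁
part-last {zero}        (𝐜 ∷ a) e ()
part-last {suc i}       (𝐜 ∷ a) e  = part-last a (suc-injective e)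
part-last {suc zero}    (𝐝 ∷ a) e  ()
part-last {suc (suc i)} (𝐝 ∷ a) e  = part-last a (suc-injective (suc-injective e))

part-suc : ∀ a i → part a i ≡ just 𝐝₁ → part a (suc i) ≡ just 𝐝₂
part-suc (𝐜 ∷ a) (suc i)       e = part-suc a i e
part-suc (𝐝 ∷ a) zero          e = refl
part-suc (𝐝 ∷ a) (suc (suc i)) e = part-suc a i e

part-pred : ∀ a i → part a i ≡ just 𝐝₂ → ∃[ j ] i ≡ suc j × part a j ≡ just 𝐝₁
part-pred (𝐜 ∷ a) (suc i) e with j , refl , e′ ← part-pred a i e = suc j , refl , e′
part-pred (𝐝 ∷ a) (suc zero) e = zero , refl , refl
part-pred (𝐝 ∷ a) (suc (suc i)) e with j , refl , e′ ← part-pred a i e = suc (suc j) , refl , e′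

part-adj : ∀ a i → part a i ≡ just 𝐝₁ → part a (suc i) ≢ just 𝐝₁
part-adj a i e e′ with () ← trans (sym e′) (part-suc a i e)

-- Equivalence of the local conditions with `Γ`.

module _ (u v : Word) where

  Γ⇒Valid : Γ u v P → Valid (part u) (part v) 0 0 P nothing
  Γ⇒Valid {P} γ = go [] P refl
    where
    open Γ γ
    open Γ₀ lattice
    linked-++⁻ʳ : ∀ {A : Set} {_~_ : A → A → Set} xs {ys} → Linked _~_ (xs ++ ys) → Linked _~_ ys
    linked-++⁻ʳ []       l = l
    linked-++⁻ʳ (x ∷ xs) l = linked-++⁻ʳ xs (Linked.tail l)
    nonRight : ∀ A s B → P ≡ A ++ s ∷ B → Upward s → NonRight (nxt B nothing)
    nonRight A s (t ∷ B) refl up refl right with no ∷ _ ← linked-++⁻ʳ A noUpRight = no (up , right)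
    allowed : ∀ A s B → P ≡ A ++ s ∷ B →
              Allowed (part u (pos Δx A 0)) (part v (pos Δy A 0)) s (nxt B nothing)
    allowed A s B e rewrite pos-0 Δx A | pos-0 Δy A = allowed′ s B e
      where
      allowed′ : ∀ s B → P ≡ A ++ s ∷ B →
                 Allowed (part u (endX A)) (part v (endY A)) s (nxt B nothing)
      allowed′ R  (R ∷ B) e refl = RR-ok A B e
      allowed′ U  B       e      = U-ok A B e , nonRight A U B e U
      allowed′ R₂ B       e      = R₂-ok A B e
      allowed′ U₂ B       e      = U₂-ok A B e , nonRight A U₂ B e U₂
      -- This `D` starts in the middle of a vertical `𝐝` label whose bottom is at height `j`. The
      -- path before it comes from height 0, so it contains a rising step that starts at height `j`.
      allowed′ D  (R ∷ B) e v₂ refl with j , eY , v₁ ← part-pred v (endY A) v₂ =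
        reachedByD (crossing A (λ A′ B′ e′ → subst (λ i → part v i ≡ _) (sym (pos-0 Δy A′))
                                 (U₂-ok A′ (B′ ++ D ∷ R ∷ B) (extendSplit A′ B′ e′)))
                             (λ { {i} refl v₁′ → part-adj v i v₁′ v₁ })
                             z≤n (≤-reflexive (trans (sym eY) (sym (pos-0 Δy A)))))
        where
        extendSplit : ∀ A′ {s} B′ → A ≡ A′ ++ s ∷ B′ → P ≡ A′ ++ s ∷ (B′ ++ D ∷ R ∷ B)
        extendSplit A′ B′ e′ = trans e (trans (cong (_++ D ∷ R ∷ B) e′) (++-assoc A′ _ _))
        reachedByD : ∃[ A′ ] ∃[ s ] ∃[ B′ ] A ≡ A′ ++ s ∷ B′ × pos Δy A′ 0 ≡ j × Rising s →
                     part u (endX A) ≢ just 𝐝₁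
        reachedByD (A′ , s , B′ , e′ , eA′ , rising) with refl ← trans (sym (pos-0 Δy A′)) eA′ | rising
        -- Condition 1 excludes `U` at the bottom of the label, and `U₂` would end above the start
        -- of the later `D`. Only `D` remains, and condition 4 applies.
        ... | U  = ⊥-elim (U-ok A′ _ (extendSplit A′ B′ e′) v₁)
        ... | U₂ = ⊥-elim (pos-≢ Δy B′ (n<1+n (suc j)) (begin
          pos Δy B′ (2 + endY A′)       ≡⟨ cong (λ i → pos Δy B′ (2 + i)) (pos-0 Δy A′) ⟨
          pos Δy B′ (2 + pos Δy A′ 0)   ≡⟨ pos-++ Δy A′ (U₂ ∷ B′) 0 ⟨
          pos Δy (A′ ++ U₂ ∷ B′) 0      ≡⟨ cong (λ C → pos Δy C 0) e′ ⟨
          pos Δy A 0                    ≡⟨ pos-0 Δy A ⟩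
          endY A                        ≡⟨ eY ⟩
          suc (endY A′)                 ∎))
          where open ≡-Reasoning
        ... | D  = DR-ok A′ _ A B (extendSplit A′ B′ e′) v₁ e eY
    go : ∀ A B → P ≡ A ++ B → Valid (part u) (part v) (pos Δx A 0) (pos Δy A 0) B nothing
    go A []      e = _
    go A (s ∷ B) e = allowed A s B e ,
      subst₂ (λ x y → Valid (part u) (part v) x y B nothing)
        (pos-++ Δx A [ s ] 0) (pos-++ Δy A [ s ] 0)
        (go (A ∷ʳ s) B (trans e (sym (++-assoc A [ s ] B))))

  Valid⇒Γ : endX P ≡ deg u → endY P ≡ deg v → Valid (part u) (part v) 0 0 P nothing → Γ u v P
  Valid⇒Γ {P} eX eY valid = record
    { lattice = record { endX≡p = eX ; endY≡q = eY ; noUpRight = linked P valid }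
    ; U-ok  = λ A B e → proj₁ (at A U B e)
    ; RR-ok = λ A B e → at A R (R ∷ B) e refl
    ; U₂-ok = λ A B e → proj₁ (at A U₂ B e)
    ; R₂-ok = λ A B e → at A R₂ B e
    -- One unit above a label `𝐝₁` is `𝐝₂`, where the local rule forbids `DR` over a `𝐝` label.
    ; DR-ok = λ A B A′ B′ e v₁ e′ eA → at A′ D (R ∷ B′) e′
                (subst (λ i → part v i ≡ just 𝐝₂) (sym eA) (part-suc v (endY A) v₁)) refl
    }
    where
    linked : ∀ {x y} P → Valid (part u) (part v) x y P nothing →
             Linked (λ s t → ¬ (Upward s × Rightward t)) P
    linked []          _       = []
    linked (s ∷ [])    _       = [-]
    linked (s ∷ t ∷ P) (a , v) = notUpRight s a ∷ linked (t ∷ P) v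
      where
      notUpRight : ∀ {h w} s → Allowed h w s (just t) → ¬ (Upward s × Rightward t)
      notUpRight U  (_ , no) (U  , right) = no refl right
      notUpRight U₂ (_ , no) (U₂ , right) = no refl right
    at : ∀ A s B → P ≡ A ++ s ∷ B → Allowed (part u (endX A)) (part v (endY A)) s (nxt B nothing)
    at A s B refl = subst₂ (λ x y → Allowed (part u x) (part v y) s (nxt B nothing))
      (pos-0 Δx A) (pos-0 Δy A) (proj₁ (proj₂ (Valid-++⁻ A (s ∷ B) valid)))


-- Truncating a path at a rising step.

Rising⇒¬Rightward : Rising s → ¬ Rightward s
Rising⇒¬Rightward () R
Rising⇒¬Rightward () R₂

multiplicity-rising : Rising s → ℤ.+ 2 ≡ multiplicity (just 𝐝₁) (just 𝐜) (just s)
multiplicity-rising U  = refl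
multiplicity-rising D  = refl
multiplicity-rising U₂ = refl

-- `h` is the axis of the truncated path, `h′` that of the whole one. In `same` the last column must
-- not be `𝐝₁`, as over that label the multiplicity of a `D` can depend on the next step, which
-- truncation removes.
data Column (h h′ : Axis) (X x : ℕ) : Set where
  same : h x ≡ h′ x → (suc x ≡ X → h x ≢ just 𝐝₁) → Column h h′ X x
  half : h x ≡ just 𝐜 → h′ x ≡ just 𝐝₁ → suc x ≡ X → Column h h′ X x

-- A path that is followed by a rising step starting at (X , Y) does not see the labels beyond
-- that point. If X is in the middle of a 𝐝 label, then the first half of that label acts on the
-- path like a 𝐜 label.
module Truncation {X Y : ℕ} {h h′ w w′ : Axis}
  (columns : ∀ {x} → x < X → Column h h′ X x)
  (rows : ∀ {y} → y < Y → w y ≡ w′ y)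
  (top : ∀ {y} → suc y ≡ Y → w y ≢ just 𝐝₁)
  (adjacent : ∀ {y} → w y ≡ just 𝐝₁ → w (suc y) ≢ just 𝐝₁)
  {s′ : Step} (rising : Rising s′)
  where

  private
    n′ : Maybe Step
    n′ = just s′

    s′≢R : n′ ≢ just R
    s′≢R e = Rising⇒¬Rightward (subst Rising (just-injective e) rising) R

    nonRight⁺ : ∀ P → NonRight (nxt P nothing) → NonRight (nxt P n′)
    nonRight⁺ []      _  refl = Rising⇒¬Rightward rising
    nonRight⁺ (s ∷ P) no = no

    nonRight⁻ : ∀ P → NonRight (nxt P n′) → NonRight (nxt P nothing)
    nonRight⁻ []      _  ()
    nonRight⁻ (s ∷ P) no = no

    right⁺ : ∀ P → nxt P nothing ≡ just R → nxt P n′ ≡ just R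
    right⁺ (s ∷ P) e = e

    right⁻ : ∀ P → nxt P n′ ≡ just R → nxt P nothing ≡ just R
    right⁻ []      e = ⊥-elim (s′≢R e)
    right⁻ (s ∷ P) e = e

    exhausted : ∀ P → pos Δx P X ≡ X → nxt P n′ ≢ just R
    exhausted []      _ e    = s′≢R e
    exhausted (R ∷ P) e refl = pos-≢ Δx P (n<1+n X) e

    below : ∀ δ P {i Z} → pos δ P i ≡ Z → i ≤ Z
    below δ P e = subst (_ ≤_) e (pos-≤ δ P _)

  allowed⁺ : ∀ s P {x y} → pos Δx (s ∷ P) x ≡ X → pos Δy (s ∷ P) y ≡ Y →
             Allowed (h x) (w y) s (nxt P nothing) → Allowed (h′ x) (w′ y) s (nxt P n′)
  allowed⁺ R P eX eY a with columns (below Δx P eX)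
  ... | same e _      = λ r → subst (_≢ just 𝐝₁) e (a (right⁻ P r))
  -- This `R` has already reached `X`, so no further `R` can follow and the rule holds vacuously.
  ... | half _ _ refl = λ r → ⊥-elim (exhausted P eX r)
  allowed⁺ U P eX eY (w≢ , no) = subst (_≢ just 𝐝₁) (rows (below Δy P eY)) w≢ , nonRight⁺ P no
  allowed⁺ D P eX eY a with columns (below Δx P eX)
  ... | same e _      = λ w₂ r → subst (_≢ just 𝐝₁) e (a (trans (rows (below Δy P eY)) w₂) (right⁻ P r))
  ... | half _ _ refl = λ _ r → ⊥-elim (exhausted P eX r)
  allowed⁺ R₂ P eX eY a with columns (<⇒≤ (below Δx P eX))
  ... | same e _   = trans (sym e) a
  ... | half e _ _ with () ← trans (sym e) a
  allowed⁺ U₂ P eX eY (w₁ , no) = trans (sym (rows (<⇒≤ (below Δy P eY)))) w₁ , nonRight⁺ P no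

  allowed⁻ : ∀ s P {x y} → pos Δx (s ∷ P) x ≡ X → pos Δy (s ∷ P) y ≡ Y →
             Allowed (h′ x) (w′ y) s (nxt P n′) → Allowed (h x) (w y) s (nxt P nothing)
  allowed⁻ R P eX eY a with columns (below Δx P eX)
  ... | same e _   = λ r → subst (_≢ just 𝐝₁) (sym e) (a (right⁺ P r))
  ... | half e _ _ = λ _ e₁ → 𝐜≢𝐝₁ (trans (sym e) e₁)
    where 𝐜≢𝐝₁ : just 𝐜 ≢ just 𝐝₁
          𝐜≢𝐝₁ ()
  allowed⁻ U P eX eY (w≢ , no) = subst (_≢ just 𝐝₁) (sym (rows (below Δy P eY))) w≢ , nonRight⁻ P no
  allowed⁻ D P eX eY a with columns (below Δx P eX)
  ... | same e _      = λ w₂ r → subst (_≢ just 𝐝₁) (sym e) (a (trans (sym (rows (below Δy P eY))) w₂) (right⁺ P r))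
  ... | half _ _ refl = λ _ r → ⊥-elim (exhausted P eX (right⁺ P r))
  allowed⁻ R₂ P eX eY a with columns (<⇒≤ (below Δx P eX))
  ... | same e _      = trans e a
  -- An `R₂` starting over the half label would end beyond `X`.
  ... | half _ _ refl = ⊥-elim (pos-≢ Δx P (n<1+n _) eX)
  allowed⁻ U₂ P eX eY (w₁ , no) = trans (rows (<⇒≤ (below Δy P eY))) w₁ , nonRight⁻ P no

  valid⁺ : ∀ P {x y} → pos Δx P x ≡ X → pos Δy P y ≡ Y →
           Valid h w x y P nothing → Valid h′ w′ x y P n′
  valid⁺ []      eX eY _       = _
  valid⁺ (s ∷ P) eX eY (a , v) = allowed⁺ s P eX eY a , valid⁺ P eX eY v

  valid⁻ : ∀ P {x y} → pos Δx P x ≡ X → pos Δy P y ≡ Y →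
           Valid h′ w′ x y P n′ → Valid h w x y P nothing
  valid⁻ []      eX eY _       = _
  valid⁻ (s ∷ P) eX eY (a , v) = allowed⁻ s P eX eY a , valid⁻ P eX eY v

  private
    multiplicity-next : ∀ h w n n′ → h ≢ just 𝐝₁ → multiplicity h w n ≡ multiplicity h w n′
    multiplicity-next nothing   w         n n′ _  = refl
    multiplicity-next (just 𝐜)  nothing   n n′ _  = refl
    multiplicity-next (just 𝐜)  (just 𝐜)  n n′ _  = refl
    multiplicity-next (just 𝐜)  (just 𝐝₁) n n′ _  = refl
    multiplicity-next (just 𝐜)  (just 𝐝₂) n n′ _  = refl
    multiplicity-next (just 𝐝₁) w         n n′ ≢𝐝₁ = ⊥-elim (≢𝐝₁ refl)
    multiplicity-next (just 𝐝₂) w         n n′ _  = refl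

    -- After this `D` no column is left, so the next step is `U`, `U₂` or, at the end of the path,
    -- the rising step `s′`. Beside `𝐜` each of these gives 2, the value over a `𝐜` label. Beside
    -- `𝐝₁` only `U` gives 2, but it is also the only case: `top` excludes ending in the middle of a
    -- vertical label, and `adjacent` excludes a `U₂` from there. Elsewhere both values are 1.
    multiplicity-half : ∀ P {y} → pos Δx P X ≡ X → pos Δy P (suc y) ≡ Y →
      Valid h w X (suc y) P nothing →
      multiplicity (just 𝐜) (w y) (nxt P nothing) ≡ multiplicity (just 𝐝₁) (w y) (nxt P n′)
    multiplicity-half P {y} eX eY v with w y in wy
    ... | nothing = refl
    ... | just 𝐝₂ = refl
    multiplicity-half [] eX eY v | just 𝐜 = multiplicity-rising rising
    multiplicity-half [] eX eY v | just 𝐝₁ = ⊥-elim (top eY wy)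
    multiplicity-half (R ∷ P) eX eY v | _ = ⊥-elim (pos-≢ Δx P (n<1+n _) eX)
    multiplicity-half (D ∷ P) eX eY v | _ = ⊥-elim (pos-≢ Δx P (n<1+n _) eX)
    multiplicity-half (R₂ ∷ P) eX eY v | _ = ⊥-elim (pos-≢ Δx P (<⇒≤ (n<1+n _)) eX)
    multiplicity-half (U ∷ P) eX eY v | just 𝐜 = refl
    multiplicity-half (U ∷ P) eX eY v | just 𝐝₁ = refl
    multiplicity-half (U₂ ∷ P) eX eY v | just 𝐜 = refl
    multiplicity-half (U₂ ∷ P) eX eY ((w₁ , _) , _) | just 𝐝₁ = ⊥-elim (adjacent wy w₁)

  mult-truncation : ∀ P {x y} → pos Δx P x ≡ X → pos Δy P y ≡ Y → Valid h w x y P nothing →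
                    mult h w x y P nothing ≡ mult h′ w′ x y P n′
  mult-truncation []      eX eY _       = refl
  mult-truncation (s ∷ P) {x} {y} eX eY (_ , v) = cong₂ ℤ._*_ (factor s refl) (mult-truncation P eX eY v)
    where
    factor : ∀ t → s ≡ t → multStep (h x) (w y) t (nxt P nothing) ≡ multStep (h′ x) (w′ y) t (nxt P n′)
    factor R  _ = refl
    factor U  _ = refl
    factor R₂ _ = refl
    factor U₂ _ = refl
    factor D refl rewrite sym (rows (below Δy P eY)) with columns (below Δx P eX)
    ... | half e e′ refl rewrite e | e′ = multiplicity-half P eX eY v
    ... | same e last rewrite sym e = factor-same P eX
      where
      factor-same : ∀ P → pos Δx P (suc x) ≡ X →
                    multiplicity (h x) (w y) (nxt P nothing) ≡ multiplicity (h x) (w y) (nxt P n′)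
      -- The next step changes only at the end of the path, hence in the last column.
      factor-same []      eX = multiplicity-next (h x) (w y) nothing n′ (last eX)
      factor-same (t ∷ P) eX = refl

-- Paths within the last row, and the recursive list of all paths.

rights : Word → Path
rights []      = []
rights (𝐜 ∷ b) = R ∷ rights b
rights (𝐝 ∷ b) = R₂ ∷ rights b

-- The paths with exactly one D step, at height 𝐝₂, in the order of the terms of G.
rightsWithD : Word → List Path
rightsWithD []      = []
rightsWithD (𝐜 ∷ b) = (D ∷ rights b) ∷ map (R ∷_) (rightsWithD b)
rightsWithD (𝐝 ∷ b) = (R ∷ D ∷ rights b) ∷ map (R₂ ∷_) (rightsWithD b)

-- What follows the D step that enters the last row, a row labelled by the given letter.
tails : Letter → Word → List Path
tails 𝐜 b = [ rights b ]
tails 𝐝 b = (rights b ∷ʳ U) ∷ rightsWithD b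

cap : Letter → Step
cap 𝐜 = U
cap 𝐝 = U₂

-- As in dia, the second word is reversed; the order is that of the terms of dia.
paths : Word → Word → List Path
paths u []      = [ rights u ]
paths u (x ∷ v) = map (_∷ʳ cap x) (paths u v) ++
  concatMap (λ (_ , a , b) → concatMap (λ P → map (λ Q → P ++ D ∷ Q) (tails x b)) (paths a v)) (Δᵂ u)

-- The labels of h on [x , X] are those of b, except that a 𝐜 may stand for a label 𝐝₂ at x.
data Tail (h : Axis) (X : ℕ) : ℕ → Word → Set where
  []   : Tail h X X []
  𝐜    : ∀ {x b} → h x ≢ just 𝐝₁ → Tail h X (suc x) b → Tail h X x (𝐜 ∷ b)
  𝐝    : ∀ {x b} → h x ≡ just 𝐝₁ → h (suc x) ≢ just 𝐝₁ → Tail h X (2 + x) b → Tail h X x (𝐝 ∷ b)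

Row : Letter → Axis → ℕ → Set
Row 𝐜 w y = w y ≡ just 𝐜
Row 𝐝 w y = w y ≡ just 𝐝₁ × w (suc y) ≡ just 𝐝₂


Tail-≤ : ∀ {h b} → Tail h X x b → x ≤ X
Tail-≤ []        = ≤-refl
Tail-≤ (𝐜 _ t)   = <⇒≤ (Tail-≤ t)
Tail-≤ (𝐝 _ _ t) = <⇒≤ (<⇒≤ (Tail-≤ t))

multiplicity-𝐝₂ : ∀ h n → multiplicity h (just 𝐝₂) n ≡ 1ℤ
multiplicity-𝐝₂ nothing   n = refl
multiplicity-𝐝₂ (just 𝐜)  n = refl
multiplicity-𝐝₂ (just 𝐝₁) n = refl
multiplicity-𝐝₂ (just 𝐝₂) n = refl

pos-rising : Rising s → ∀ P → pos Δy P (Δy s + y) ≢ y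
pos-rising U  P = pos-≢ Δy P (n<1+n _)
pos-rising D  P = pos-≢ Δy P (n<1+n _)
pos-rising U₂ P = pos-≢ Δy P (m<n⇒m<1+n (n<1+n _))

afterUp : ∀ P → NonRight (nxt P nothing) → pos Δy P y ≡ y → P ≡ []
afterUp []       no eY = refl
afterUp (R ∷ P)  no eY = ⊥-elim (no refl R)
afterUp (R₂ ∷ P) no eY = ⊥-elim (no refl R₂)
afterUp (U ∷ P)  no eY = ⊥-elim (pos-rising U P eY)
afterUp (D ∷ P)  no eY = ⊥-elim (pos-rising D P eY)
afterUp (U₂ ∷ P) no eY = ⊥-elim (pos-rising U₂ P eY)

module _ {h w : Axis} {X : ℕ} where

  record Runs (x y Y : ℕ) (P : Path) : Set where
    constructor runs
    field
      valid  : Valid h w x y P nothing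
      endsX  : pos Δx P x ≡ X
      endsY  : pos Δy P y ≡ Y
      mult≡1 : mult h w x y P nothing ≡ 1ℤ

  private
    prepend : ∀ s → Allowed (h x) (w y) s (nxt P nothing) →
              multStep (h x) (w y) s (nxt P nothing) ≡ 1ℤ →
              Runs (Δx s + x) (Δy s + y) Y P → Runs x y Y (s ∷ P)
    prepend s a k (runs v eX eY m) = runs (a , v) eX eY (cong₂ ℤ._*_ k m)

    not𝐝₁ : w y ≡ just 𝐝₂ → w y ≢ just 𝐝₁
    not𝐝₁ e e′ with () ← trans (sym e) e′

    prependD : w y ≡ just 𝐝₂ → h x ≢ just 𝐝₁ → Runs (suc x) (suc y) Y P → Runs x y Y (D ∷ P)
    prependD {x = x} e ≢𝐝₁ r =
      prepend D (λ _ _ → ≢𝐝₁) (trans (cong (λ p → multiplicity (h x) p _) e) (multiplicity-𝐝₂ (h x) _)) r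

  rights-runs : ∀ {b} → Tail h X x b → Runs x y y (rights b)
  rights-runs []          = runs _ refl refl refl
  rights-runs (𝐜 ≢𝐝₁ t)   = prepend R (λ _ → ≢𝐝₁) refl (rights-runs t)
  rights-runs (𝐝 ≡𝐝₁ _ t) = prepend R₂ ≡𝐝₁ refl (rights-runs t)

  rights∷ʳU-runs : ∀ {b} → w y ≡ just 𝐝₂ → Tail h X x b → Runs x y (suc y) (rights b ∷ʳ U)
  rights∷ʳU-runs e []          = runs ((not𝐝₁ e , λ ()) , _) refl refl refl
  rights∷ʳU-runs e (𝐜 ≢𝐝₁ t)   = prepend R (λ _ → ≢𝐝₁) refl (rights∷ʳU-runs e t)
  rights∷ʳU-runs e (𝐝 ≡𝐝₁ _ t) = prepend R₂ ≡𝐝₁ refl (rights∷ʳU-runs e t)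

  rightsWithD-runs : ∀ {b} → w y ≡ just 𝐝₂ → Tail h X x b → All (Runs x y (suc y)) (rightsWithD b)
  rightsWithD-runs e []            = []
  rightsWithD-runs e (𝐜 ≢𝐝₁ t)     = prependD e ≢𝐝₁ (rights-runs t) ∷
    All.map⁺ (All.map (prepend R (λ _ → ≢𝐝₁) refl) (rightsWithD-runs e t))
  rightsWithD-runs e (𝐝 ≡𝐝₁ ≢𝐝₁ t) = prepend R (λ ()) refl (prependD e ≢𝐝₁ (rights-runs t)) ∷
    All.map⁺ (All.map (prepend R₂ ≡𝐝₁ refl) (rightsWithD-runs e t))

  -- The entering `D` ends at the top of a `𝐜` row but only in the middle of a `𝐝` row. A further
  -- `D` there stands beside `𝐝₂` and has multiplicity 1, so the tails carry no coefficient.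
  tails-runs : ∀ l {b} → Row l w y → Tail h X x b →
               All (Runs x (suc y) (Δy (cap l) + y)) (tails l b)
  tails-runs 𝐜 e       t = rights-runs t ∷ []
  tails-runs 𝐝 (_ , e) t = rights∷ʳU-runs e t ∷ rightsWithD-runs e t

  -- Rising steps would leave the height for good. A `𝐝` label can be crossed only by `R₂`: after an
  -- `R` over its first part, a second `R` is forbidden and an `R₂` cannot start at the second part.
  rights-complete : ∀ {b} P → Tail h X x b → Valid h w x y P nothing →
                    pos Δx P x ≡ X → pos Δy P y ≡ y → P ≡ rights b
  rights-complete (U ∷ P)      _             _             eX eY = ⊥-elim (pos-rising U P eY)
  rights-complete (D ∷ P)      _             _             eX eY = ⊥-elim (pos-rising D P eY)
  rights-complete (U₂ ∷ P)     _             _             eX eY = ⊥-elim (pos-rising U₂ P eY)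
  rights-complete []           []            _             eX eY = refl
  rights-complete (R ∷ P)      []            _             eX eY = ⊥-elim (pos-≢ Δx P (n<1+n _) eX)
  rights-complete (R₂ ∷ P)     []            _             eX eY = ⊥-elim (pos-≢ Δx P (m<n⇒m<1+n (n<1+n _)) eX)
  rights-complete []           (𝐜 _ t)       _             eX eY = ⊥-elim (<⇒≢ (Tail-≤ t) eX)
  rights-complete (R ∷ P)      (𝐜 _ t)       (_ , v)       eX eY = cong (R ∷_) (rights-complete P t v eX eY)
  rights-complete (R₂ ∷ P)     (𝐜 ≢𝐝₁ t)     (≡𝐝₁ , _)     eX eY = ⊥-elim (≢𝐝₁ ≡𝐝₁)
  rights-complete []           (𝐝 _ _ t)     _             eX eY = ⊥-elim (<⇒≢ (<⇒≤ (Tail-≤ t)) eX)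
  rights-complete (R₂ ∷ P)     (𝐝 _ _ t)     (_ , v)       eX eY = cong (R₂ ∷_) (rights-complete P t v eX eY)
  rights-complete (R ∷ [])     (𝐝 _ _ t)     _             eX eY = ⊥-elim (<⇒≢ (Tail-≤ t) eX)
  rights-complete (R ∷ R ∷ P)  (𝐝 ≡𝐝₁ _ t)   (no , _)      eX eY = ⊥-elim (no refl ≡𝐝₁)
  rights-complete (R ∷ R₂ ∷ P) (𝐝 _ ≢𝐝₁ t)   (_ , ≡𝐝₁ , _) eX eY = ⊥-elim (≢𝐝₁ ≡𝐝₁)
  rights-complete (R ∷ U ∷ P)  (𝐝 _ _ t)     _             eX eY = ⊥-elim (pos-rising U P eY)
  rights-complete (R ∷ D ∷ P)  (𝐝 _ _ t)     _             eX eY = ⊥-elim (pos-rising D P eY)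
  rights-complete (R ∷ U₂ ∷ P) (𝐝 _ _ t)     _             eX eY = ⊥-elim (pos-rising U₂ P eY)

  private
    prepend-∈ : ∀ {s b b′} → rights b′ ≡ s ∷ rights b →
      (∀ {P} → P ∈ rightsWithD b → s ∷ P ∈ rightsWithD b′) →
      P ∈ tails 𝐝 b → s ∷ P ∈ tails 𝐝 b′
    prepend-∈ e f (here refl) = here (sym (cong (_∷ʳ U) e))
    prepend-∈ e f (there p)   = there (f p)

    early-U : ∀ P → x < X → Valid h w x y (U ∷ P) nothing →
              pos Δx P x ≡ X → pos Δy P (suc y) ≢ suc y
    early-U P x<X ((_ , no) , _) eX eY with refl ← afterUp P no eY = <⇒≢ x<X eX

  -- Exactly one unit is to be climbed. A `U` has to come last, since no right step may follow it. A
  -- `D` over the first part of a `𝐝` label cannot be continued: `R` is forbidden beside `𝐝₂`, `R₂`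
  -- cannot start at the second part, and rising steps are too high. So over a `𝐝` label the `D`
  -- comes second, after an `R`.
  tails𝐝-complete : ∀ {b} P → w y ≡ just 𝐝₂ → Tail h X x b → Valid h w x y P nothing →
                    pos Δx P x ≡ X → pos Δy P y ≡ suc y → P ∈ tails 𝐝 b
  tails𝐝-complete []       e _  _               eX eY = ⊥-elim (<⇒≢ (n<1+n _) eY)
  tails𝐝-complete (U₂ ∷ P) e _  ((≡𝐝₁ , _) , _) eX eY = ⊥-elim (not𝐝₁ e ≡𝐝₁)
  tails𝐝-complete (U ∷ P)  e [] ((_ , no) , _)  eX eY with refl ← afterUp P no eY = here refl
  tails𝐝-complete (R ∷ P)  e [] _               eX eY = ⊥-elim (pos-≢ Δx P (n<1+n _) eX)
  tails𝐝-complete (D ∷ P)  e [] _               eX eY = ⊥-elim (pos-≢ Δx P (n<1+n _) eX)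
  tails𝐝-complete (R₂ ∷ P) e [] _               eX eY = ⊥-elim (pos-≢ Δx P (m<n⇒m<1+n (n<1+n _)) eX)
  tails𝐝-complete (U ∷ P)  e (𝐜 _ t)   v           eX eY = ⊥-elim (early-U P (Tail-≤ t) v eX eY)
  tails𝐝-complete (R₂ ∷ P) e (𝐜 ≢𝐝₁ t) (≡𝐝₁ , _)   eX eY = ⊥-elim (≢𝐝₁ ≡𝐝₁)
  tails𝐝-complete (R ∷ P)  e (𝐜 _ t)   (_ , v)     eX eY =
    prepend-∈ {b′ = 𝐜 ∷ _} refl (there ∘ ∈-map⁺ (R ∷_)) (tails𝐝-complete P e t v eX eY)
  tails𝐝-complete (D ∷ P)  e (𝐜 _ t)   (_ , v)     eX eY =
    there (here (cong (D ∷_) (rights-complete P t v eX eY)))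
  tails𝐝-complete (U ∷ P)  e (𝐝 _ _ t) v           eX eY = ⊥-elim (early-U P (<⇒≤ (Tail-≤ t)) v eX eY)
  tails𝐝-complete (R₂ ∷ P) e (𝐝 _ _ t) (_ , v)     eX eY =
    prepend-∈ {b′ = 𝐝 ∷ _} refl (there ∘ ∈-map⁺ (R₂ ∷_)) (tails𝐝-complete P e t v eX eY)
  tails𝐝-complete (D ∷ [])     e (𝐝 _ _ t)   _                eX eY = ⊥-elim (<⇒≢ (Tail-≤ t) eX)
  tails𝐝-complete (D ∷ R ∷ P)  e (𝐝 ≡𝐝₁ _ t) (no , _)         eX eY = ⊥-elim (no e refl ≡𝐝₁)
  tails𝐝-complete (D ∷ R₂ ∷ P) e (𝐝 _ ≢𝐝₁ t) (_ , ≡𝐝₁ , _)    eX eY = ⊥-elim (≢𝐝₁ ≡𝐝₁)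
  tails𝐝-complete (D ∷ U ∷ P)  e (𝐝 _ _ t)   _                eX eY = ⊥-elim (pos-rising U P eY)
  tails𝐝-complete (D ∷ D ∷ P)  e (𝐝 _ _ t)   _                eX eY = ⊥-elim (pos-rising D P eY)
  tails𝐝-complete (D ∷ U₂ ∷ P) e (𝐝 _ _ t)   _                eX eY = ⊥-elim (pos-rising U₂ P eY)
  tails𝐝-complete (R ∷ [])     e (𝐝 _ _ t)   _                eX eY = ⊥-elim (<⇒≢ (Tail-≤ t) eX)
  tails𝐝-complete (R ∷ R ∷ P)  e (𝐝 ≡𝐝₁ _ t) (no , _)         eX eY = ⊥-elim (no refl ≡𝐝₁)
  tails𝐝-complete (R ∷ R₂ ∷ P) e (𝐝 _ ≢𝐝₁ t) (_ , ≡𝐝₁ , _)    eX eY = ⊥-elim (≢𝐝₁ ≡𝐝₁)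
  tails𝐝-complete (R ∷ U ∷ P)  e (𝐝 _ _ t)   (_ , v)          eX eY = ⊥-elim (early-U P (Tail-≤ t) v eX eY)
  tails𝐝-complete (R ∷ U₂ ∷ P) e (𝐝 _ _ t)   (_ , (≡𝐝₁ , _) , _) eX eY = ⊥-elim (not𝐝₁ e ≡𝐝₁)
  tails𝐝-complete (R ∷ D ∷ P)  e (𝐝 _ _ t)   (_ , _ , v)      eX eY =
    there (here (cong (λ P → R ∷ D ∷ P) (rights-complete P t v eX eY)))

  tails-complete : ∀ l {b} P → Row l w y → Tail h X x b → Valid h w x (suc y) P nothing →
                   pos Δx P x ≡ X → pos Δy P (suc y) ≡ Δy (cap l) + y → P ∈ tails l b
  tails-complete 𝐜 P _       t v eX eY = here (rights-complete P t v eX eY)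
  tails-complete 𝐝 P (_ , e) t v eX eY = tails𝐝-complete P e t v eX eY

tails-unique : ∀ l b → Unique (tails l b)
tails-unique 𝐜 b = [] ∷ []
tails-unique 𝐝 b = fresh b ∷ unique b
  where
  fresh : ∀ b → All (rights b ∷ʳ U ≢_) (rightsWithD b)
  fresh []      = []
  fresh (𝐜 ∷ b) = (λ ()) ∷ All.map⁺ (All.map (_∘ ∷-injectiveʳ) (fresh b))
  fresh (𝐝 ∷ b) = (λ ()) ∷ All.map⁺ (All.map (_∘ ∷-injectiveʳ) (fresh b))
  unique : ∀ b → Unique (rightsWithD b)
  unique []      = []
  unique (𝐜 ∷ b) = All.map⁺ (All.universal (λ _ ()) _) ∷ Unique.map⁺ ∷-injectiveʳ (unique b)
  unique (𝐝 ∷ b) = All.map⁺ (All.universal (λ _ ()) _) ∷ Unique.map⁺ ∷-injectiveʳ (unique b)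

-- Terms of the coproduct as cuts of the horizontal axis.

data Kind : Maybe Part → ℤ → Word → Set where
  full   : ∀ {b} → Kind (just 𝐜) (ℤ.+ 2) b
  first  : ∀ {b} → Kind (just 𝐝₁) 1ℤ (𝐜 ∷ b)
  second : ∀ {b} → Kind (just 𝐝₂) 1ℤ b

-- The delicate case is `first`: as `b` begins with `𝐜`, the entering `D` is followed by `R` in a
-- `𝐜` row, and by `R` or `D` in a `𝐝` row. These are just the continuations that do not double the
-- weight.
Kind-multiplicity : ∀ l {w h k b y} → Row l w y → Kind h k b →
                    All (λ Q → multiplicity h (w y) (nxt Q nothing) ≡ k) (tails l b)
Kind-multiplicity 𝐜 e       full   rewrite e = refl ∷ []
Kind-multiplicity 𝐜 e       first  rewrite e = refl ∷ []
Kind-multiplicity 𝐜 _       second           = refl ∷ []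
Kind-multiplicity 𝐝 (e , _) full   rewrite e = All.universal (λ _ → refl) _
Kind-multiplicity 𝐝 (e , _) first  rewrite e = refl ∷ refl ∷ All.map⁺ (All.universal (λ _ → refl) _)
Kind-multiplicity 𝐝 _       second           = All.universal (λ _ → refl) _

-- The entering `D` lies over column `deg a`. The fields describe the axis to the left of this
-- column, to the right of it, and the column itself.
record Split (u : Word) (t : ℤ × Word × Word) : Set where
  constructor split
  k = proj₁ t
  a = proj₁ (proj₂ t)
  b = proj₂ (proj₂ t)
  field
    columns : ∀ {x} → x < deg a → Column (part a) (part u) (deg a) x
    tail    : Tail (part u) (deg u) (suc (deg a)) b
    kind    : Kind (part u (deg a)) k b

Tail-suc : ∀ {h b} → Tail (h ∘ suc) X x b → Tail h (suc X) (suc x) b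
Tail-suc []        = []
Tail-suc (𝐜 e t)   = 𝐜 e (Tail-suc t)
Tail-suc (𝐝 e f t) = 𝐝 e f (Tail-suc t)

Tail-part : ∀ u → Tail (part u) (deg u) 0 u
Tail-part []      = []
Tail-part (𝐜 ∷ u) = 𝐜 (λ ()) (Tail-suc (Tail-part u))
Tail-part (𝐝 ∷ u) = 𝐝 refl (λ ()) (Tail-suc (Tail-suc (Tail-part u)))

Column-suc : ∀ {h h′} → Column (h ∘ suc) (h′ ∘ suc) X x → Column h h′ (suc X) (suc x)
Column-suc (same e f)   = same e (f ∘ suc-injective)
Column-suc (half e f g) = half e f (cong suc g)

Split-∷ : ∀ x {u k a b} → Split u (k , a , b) → Split (x ∷ u) (k , x ∷ a , b)
Split-∷ 𝐜 {u} {a = a} (split col tl kd) = split columns (Tail-suc tl) kd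
  where
  columns : ∀ {x} → x < suc (deg a) → Column (part (𝐜 ∷ a)) (part (𝐜 ∷ u)) (suc (deg a)) x
  columns {zero}  _       = same refl λ _ ()
  columns {suc x} (s≤s l) = Column-suc (col l)
Split-∷ 𝐝 {u} {a = a} (split col tl kd) = split columns (Tail-suc (Tail-suc tl)) kd
  where
  columns : ∀ {x} → x < 2 + deg a → Column (part (𝐝 ∷ a)) (part (𝐝 ∷ u)) (2 + deg a) x
  columns {zero}        _             = same refl λ ()
  columns {suc zero}    _             = same refl λ _ ()
  columns {suc (suc x)} (s≤s (s≤s l)) = Column-suc (Column-suc (col l))

Δᵂ-splits : ∀ u → All (Split u) (Δᵂ u)
Δᵂ-splits []      = []
Δᵂ-splits (𝐜 ∷ u) =
  split (λ ()) (Tail-suc (Tail-part u)) full ∷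
  All.map⁺ (All.map (Split-∷ 𝐜) (Δᵂ-splits u))
Δᵂ-splits (𝐝 ∷ u) =
  -- Cut at the first part: the second part is left over and read as the `𝐜` that begins `b`.
  split (λ ()) (𝐜 (λ ()) (Tail-suc (Tail-suc (Tail-part u)))) first ∷
  -- Cut at the second part: the first part is left over and read as the `𝐜` that ends `a`.
  split (λ { (s≤s z≤n) → half refl refl refl }) (Tail-suc (Tail-suc (Tail-part u))) second ∷
  All.map⁺ (All.map (Split-∷ 𝐝) (Δᵂ-splits u))

cut : ℤ × Word × Word → ℕ
cut (_ , a , _) = deg a

-- A `𝐜` yields one term and a `𝐝` two, so every column is the cut of some term. `Δᵂ-cuts-distinct`
-- adds that this term is unique.
Δᵂ-cuts : ∀ u → x < deg u → Any ((x ≡_) ∘ cut) (Δᵂ u)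
Δᵂ-cuts {zero}        (𝐜 ∷ u) _             = here refl
Δᵂ-cuts {suc x}       (𝐜 ∷ u) (s≤s l)       = there (Any.map⁺ (Any.map (cong suc) (Δᵂ-cuts u l)))
Δᵂ-cuts {zero}        (𝐝 ∷ u) _             = here refl
Δᵂ-cuts {suc zero}    (𝐝 ∷ u) _             = there (here refl)
Δᵂ-cuts {suc (suc x)} (𝐝 ∷ u) (s≤s (s≤s l)) =
  there (there (Any.map⁺ (Any.map (cong (2 +_)) (Δᵂ-cuts u l))))

Δᵂ-cuts-distinct : ∀ u → AllPairs (λ s t → cut s ≢ cut t) (Δᵂ u)
Δᵂ-cuts-distinct []      = []
Δᵂ-cuts-distinct (𝐜 ∷ u) =
  All.map⁺ (All.universal (λ _ ()) _) ∷
  AllPairs.map⁺ (AllPairs.map (_∘ suc-injective) (Δᵂ-cuts-distinct u))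
Δᵂ-cuts-distinct (𝐝 ∷ u) =
  ((λ ()) ∷ All.map⁺ (All.universal (λ _ ()) _)) ∷
  All.map⁺ (All.universal (λ _ ()) _) ∷
  AllPairs.map⁺ (AllPairs.map (_∘ suc-injective ∘ suc-injective) (Δᵂ-cuts-distinct u))

concatMap-unique : {A B : Set} (f : A → List B) {xs : List A} → All (Unique ∘ f) xs →
                   AllPairs (λ x y → Disjoint (f x) (f y)) xs → Unique (concatMap f xs)
concatMap-unique f us ds = Unique.concat⁺ (All.map⁺ us) (AllPairs.map⁺ ds)

concatMap-All : {A B : Set} {R : B → Set} (f : A → List B) {xs : List A} →
                All (All R ∘ f) xs → All R (concatMap f xs)
concatMap-All f rs = All.concat⁺ (All.map⁺ rs)

-- If one prefix were longer, it would contain the rising step that follows the other and thus end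
-- above the common height.
crossing-unique : ∀ P P′ {Q Q′} → Rising s → Rising t → P ++ s ∷ Q ≡ P′ ++ t ∷ Q′ →
                  pos Δy P y ≡ pos Δy P′ y → P ≡ P′ × s ≡ t × Q ≡ Q′
crossing-unique []      []       _ _ refl _ = refl , refl , refl
crossing-unique []      (x ∷ P′) r _ refl e = ⊥-elim (pos-rising r P′ (sym e))
crossing-unique (x ∷ P) []       _ r refl e = ⊥-elim (pos-rising r P e)
crossing-unique (x ∷ P) (x′ ∷ P′) r r′ e e′ with refl , e″ ← ∷-injective e
  with refl , s≡t , Q≡Q′ ← crossing-unique P P′ r r′ e″ e′ = refl , s≡t , Q≡Q′

-- The vertical axis; its word is reversed, so that a new letter adds the top row.

axis : Word → Axis
axis v = part (reverse v)

part-++ˡ : ∀ a b → i < deg a → part (a ++ b) i ≡ part a i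
part-++ˡ {zero}        (𝐜 ∷ a) b _             = refl
part-++ˡ {suc i}       (𝐜 ∷ a) b (s≤s l)       = part-++ˡ a b l
part-++ˡ {zero}        (𝐝 ∷ a) b _             = refl
part-++ˡ {suc zero}    (𝐝 ∷ a) b _             = refl
part-++ˡ {suc (suc i)} (𝐝 ∷ a) b (s≤s (s≤s l)) = part-++ˡ a b l

part-∷ʳ : ∀ a x → Row x (part (a ∷ʳ x)) (deg a)
part-∷ʳ []      𝐜 = refl
part-∷ʳ []      𝐝 = refl , refl
part-∷ʳ (𝐜 ∷ a) 𝐜 = part-∷ʳ a 𝐜
part-∷ʳ (𝐜 ∷ a) 𝐝 = part-∷ʳ a 𝐝
part-∷ʳ (𝐝 ∷ a) 𝐜 = part-∷ʳ a 𝐜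
part-∷ʳ (𝐝 ∷ a) 𝐝 = part-∷ʳ a 𝐝

deg-∷ : ∀ x v → deg (x ∷ v) ≡ Δy (cap x) + deg v
deg-∷ 𝐜 v = refl
deg-∷ 𝐝 v = refl

deg-< : ∀ x v → deg v < deg (x ∷ v)
deg-< 𝐜 v = n<1+n _
deg-< 𝐝 v = m<n⇒m<1+n (n<1+n _)

deg-∷ʳ : ∀ a x → deg (a ∷ʳ x) ≡ deg (x ∷ a)
deg-∷ʳ []      x = refl
deg-∷ʳ (𝐜 ∷ a) 𝐜 = cong suc (deg-∷ʳ a 𝐜)
deg-∷ʳ (𝐜 ∷ a) 𝐝 = cong suc (deg-∷ʳ a 𝐝)
deg-∷ʳ (𝐝 ∷ a) 𝐜 = cong (2 +_) (deg-∷ʳ a 𝐜)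
deg-∷ʳ (𝐝 ∷ a) 𝐝 = cong (2 +_) (deg-∷ʳ a 𝐝)

deg-reverse : ∀ v → deg (reverse v) ≡ deg v
deg-reverse []      = refl
deg-reverse (x ∷ v) = begin
  deg (reverse (x ∷ v))         ≡⟨ cong deg (unfold-reverse x v) ⟩
  deg (reverse v ∷ʳ x)          ≡⟨ deg-∷ʳ (reverse v) x ⟩
  deg (x ∷ reverse v)           ≡⟨ deg-∷ x (reverse v) ⟩
  Δy (cap x) + deg (reverse v)  ≡⟨ cong (Δy (cap x) +_) (deg-reverse v) ⟩
  Δy (cap x) + deg v            ≡⟨ deg-∷ x v ⟨
  deg (x ∷ v)                   ∎
  where open ≡-Reasoning

axis-below : ∀ x v → y < deg v → axis v y ≡ axis (x ∷ v) y
axis-below x v l rewrite unfold-reverse x v =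
  sym (part-++ˡ (reverse v) [ x ] (subst (_ <_) (sym (deg-reverse v)) l))

axis-row : ∀ x v → Row x (axis (x ∷ v)) (deg v)
axis-row x v = subst₂ (λ r d → Row x (part r) d) (sym (unfold-reverse x v)) (deg-reverse v)
                 (part-∷ʳ (reverse v) x)

axis-top : ∀ v → suc y ≡ deg v → axis v y ≢ just 𝐝₁
axis-top v e = part-last (reverse v) (trans e (sym (deg-reverse v)))

Row-≢𝐝₂ : ∀ x {w} → Row x w y → w y ≢ just 𝐝₂
Row-≢𝐝₂ 𝐜 e       e′ with () ← trans (sym e) e′
Row-≢𝐝₂ 𝐝 (e , _) e′ with () ← trans (sym e) e′

cap-rising : ∀ x → Rising (cap x)
cap-rising 𝐜 = U
cap-rising 𝐝 = U₂

Δx-cap : ∀ x → Δx (cap x) ≡ 0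
Δx-cap 𝐜 = refl
Δx-cap 𝐝 = refl

multStep-cap : ∀ x {h w} → multStep h w (cap x) n ≡ 1ℤ
multStep-cap 𝐜 = refl
multStep-cap 𝐝 = refl

weightLetter-cap : ∀ x → weightLetter (cap x) ≡ x
weightLetter-cap 𝐜 = refl
weightLetter-cap 𝐝 = refl

cap-allowed : ∀ x {h w} → Row x w y → Allowed h (w y) (cap x) nothing
cap-allowed 𝐜 e       = (λ e′ → case trans (sym e) e′ of λ ()) , λ ()
cap-allowed 𝐝 (e , _) = e , λ ()

upward⇒cap : ∀ x {h w} → Row x w y → Upward s → Allowed h (w y) s n → s ≡ cap x × NonRight n
upward⇒cap 𝐜 e       U  (_  , no) = refl , no
upward⇒cap 𝐜 e       U₂ (e′ , no) = case trans (sym e) e′ of λ ()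
upward⇒cap 𝐝 (e , _) U  (≢  , no) = ⊥-elim (≢ e)
upward⇒cap 𝐝 _       U₂ (_  , no) = refl , no

-- Gluing paths at the entry into the last row.

record Admissible (u v : Word) (P : Path) : Set where
  constructor admissible
  field
    valid : Valid (part u) (axis v) 0 0 P nothing
    endsX : pos Δx P 0 ≡ deg u
    endsY : pos Δy P 0 ≡ deg v

multOf : Word → Word → Path → ℤ
multOf u v P = mult (part u) (axis v) 0 0 P nothing

-- The cut is at (`deg a` , `deg v`), where `s` enters the row of `x`. `glue` shows that the listed
-- paths are admissible, `unglue` that the list is complete.
module Glue {a u : Word} (x : Letter) (v : Word)
  (columns : ∀ {i} → i < deg a → Column (part a) (part u) (deg a) i) (rising : Rising s) where

  open Truncation columns (axis-below x v) (axis-top v) (part-adj (reverse v) _) rising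

  ValidEnd : Path → Set
  ValidEnd Q = Valid (part u) (axis (x ∷ v)) (deg a) (deg v) (s ∷ Q) nothing ×
               pos Δx Q (Δx s + deg a) ≡ deg u × pos Δy Q (Δy s + deg v) ≡ deg (x ∷ v)

  glue : Admissible a v P → ValidEnd Q → Admissible u (x ∷ v) (P ++ s ∷ Q) ×
         multOf u (x ∷ v) (P ++ s ∷ Q) ≡
         multOf a v P ℤ.* mult (part u) (axis (x ∷ v)) (deg a) (deg v) (s ∷ Q) nothing
  glue {P} {Q} (admissible vP eX eY) (vQ , eX′ , eY′) =
    admissible
      (Valid-++⁺ P (s ∷ Q) (valid⁺ P eX eY vP)
        (subst₂ (λ i j → Valid (part u) (axis (x ∷ v)) i j (s ∷ Q) nothing) (sym eX) (sym eY) vQ))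
      (trans (pos-++ Δx P (s ∷ Q) 0) (trans (cong (pos Δx (s ∷ Q)) eX) eX′))
      (trans (pos-++ Δy P (s ∷ Q) 0) (trans (cong (pos Δy (s ∷ Q)) eY) eY′)) ,
    trans (mult-++ P (s ∷ Q)) (cong₂ ℤ._*_
      (sym (mult-truncation P eX eY vP))
      (cong₂ (λ i j → mult (part u) (axis (x ∷ v)) i j (s ∷ Q) nothing) eX eY))

  unglue : pos Δx P 0 ≡ deg a → pos Δy P 0 ≡ deg v → Admissible u (x ∷ v) (P ++ s ∷ Q) →
           Admissible a v P × ValidEnd Q
  unglue {P} {Q} eX eY (admissible vPQ eX′ eY′) with vP , vQ ← Valid-++⁻ P (s ∷ Q) vPQ =
    admissible (valid⁻ P eX eY vP) eX eY ,
    subst₂ (λ i j → Valid (part u) (axis (x ∷ v)) i j (s ∷ Q) nothing) eX eY vQ ,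
    trans (cong (pos Δx (s ∷ Q)) (sym eX)) (trans (sym (pos-++ Δx P (s ∷ Q) 0)) eX′) ,
    trans (cong (pos Δy (s ∷ Q)) (sym eY)) (trans (sym (pos-++ Δy P (s ∷ Q) 0)) eY′)

wholeColumns : ∀ u → x < deg u → Column (part u) (part u) (deg u) x
wholeColumns u _ = same refl (part-last u)

-- The horizontal axis stays whole. For `P` the only change is that a step follows it, which
-- truncation covers, and this step contributes the factor 1.
capped : ∀ u x v → Admissible u v P →
         Admissible u (x ∷ v) (P ∷ʳ cap x) × multOf u (x ∷ v) (P ∷ʳ cap x) ≡ multOf u v P
capped {P} u x v ad with ad′ , m ← Glue.glue x v (wholeColumns u) (cap-rising x) {Q = []} ad
  ((cap-allowed x (axis-row x v) , _) , cong (_+ deg u) (Δx-cap x) , sym (deg-∷ x v)) = ad′ , (begin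
  multOf u (x ∷ v) (P ∷ʳ cap x)
    ≡⟨ m ⟩
  multOf u v P ℤ.* (multStep (part u (deg u)) (axis (x ∷ v) (deg v)) (cap x) nothing ℤ.* 1ℤ)
    ≡⟨ cong (λ k → multOf u v P ℤ.* (k ℤ.* 1ℤ)) (multStep-cap x) ⟩
  multOf u v P ℤ.* 1ℤ
    ≡⟨ ℤ.*-identityʳ _ ⟩
  multOf u v P ∎)
  where open ≡-Reasoning

-- The factor `k` is the multiplicity of the entering `D`; the tail after it contributes 1.
joined : ∀ {u t} x v → Split u t → let k , a , b = t in Admissible a v P →
         All (λ Q → Admissible u (x ∷ v) (P ++ D ∷ Q) ×
                    multOf u (x ∷ v) (P ++ D ∷ Q) ≡ multOf a v P ℤ.* k) (tails x b)
joined {P = P} {u} {k , a , b} x v (split columns tail kind) ad =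
  All.map join (All.zip (tails-runs x (axis-row x v) tail , Kind-multiplicity x (axis-row x v) kind))
  where
  join : ∀ {Q} → Runs (suc (deg a)) (suc (deg v)) (Δy (cap x) + deg v) Q ×
           multiplicity (part u (deg a)) (axis (x ∷ v) (deg v)) (nxt Q nothing) ≡ k →
         Admissible u (x ∷ v) (P ++ D ∷ Q) ×
         multOf u (x ∷ v) (P ++ D ∷ Q) ≡ multOf a v P ℤ.* k
  join (runs vQ eX eY m , mD) with ad′ , m′ ← Glue.glue x v columns D ad
    -- The lowest unit of a row is `𝐜` or `𝐝₁`, so the rule for a `D` beside `𝐝₂` is vacuous.
    (((λ e → ⊥-elim (Row-≢𝐝₂ x (axis-row x v) e)) , vQ) , eX , trans eY (sym (deg-∷ x v))) =
    ad′ , trans m′ (cong (multOf a v P ℤ.*_) (trans (cong₂ ℤ._*_ mD m) (ℤ.*-identityʳ k)))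

-- The recursive list contains every admissible path exactly once.

pathsAt : Letter → Word → ℤ × Word × Word → List Path
pathsAt x v (_ , a , b) = concatMap (λ P → map (λ Q → P ++ D ∷ Q) (tails x b)) (paths a v)

paths-admissible : ∀ u v → All (Admissible u v) (paths u v)
paths-admissible u []      with runs v eX eY _ ← rights-runs (Tail-part u) = admissible v eX eY ∷ []
paths-admissible u (x ∷ v) = All.++⁺
  (All.map⁺ (All.map (λ ad → proj₁ (capped u x v ad)) (paths-admissible u v)))
  (concatMap-All (pathsAt x v) (All.map
    (λ sp → concatMap-All _ (All.map
      (λ ad → All.map⁺ (All.map proj₁ (joined x v sp ad)))
      (paths-admissible _ v)))
    (Δᵂ-splits u)))

paths-complete : ∀ u v {P} → Admissible u v P → P ∈ paths u v
paths-complete u []      {P} (admissible valid eX eY) = here (rights-complete P (Tail-part u) valid eX eY)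
paths-complete u (x ∷ v) {P} ad@(admissible valid eX eY)
  -- The path is cut at height `deg v`, the bottom of the last row. No `U₂` jumps over it, since the
  -- unit beneath is the last one of `v`.
  with A , s , B , refl , eA , rising ← crossing P
    (λ A B e → proj₁ (proj₁ (proj₂ (Valid-++⁻ A (U₂ ∷ B) (subst (λ P → Valid _ _ 0 0 P nothing) e valid)))))
    (λ e → subst (_≢ just 𝐝₁) (axis-below x v (≤-reflexive e)) (axis-top v e))
    z≤n (subst (deg v <_) (sym eY) (deg-< x v))
  = go rising
  where
  open ≡-Reasoning
  valid-A++ = Valid-++⁻ A (s ∷ B) valid
  up : Upward s → A ++ s ∷ B ∈ paths u (x ∷ v)
  -- The label of the row leaves `cap x` as the only upward step. It reaches the final height and no
  -- right step may follow, so `B` is empty and the step lies at `deg u`.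
  up r with refl , no ← upward⇒cap x (subst (Row x _) (sym eA) (axis-row x v)) r (proj₁ (proj₂ valid-A++))
    with refl ← afterUp B no (begin
      pos Δy B (Δy (cap x) + pos Δy A 0)   ≡⟨ pos-++ Δy A (cap x ∷ B) 0 ⟨
      pos Δy (A ++ cap x ∷ B) 0            ≡⟨ eY ⟩
      deg (x ∷ v)                          ≡⟨ deg-∷ x v ⟩
      Δy (cap x) + deg v                   ≡⟨ cong (Δy (cap x) +_) eA ⟨
      Δy (cap x) + pos Δy A 0              ∎)
    with adA , _ ← Glue.unglue x v (wholeColumns u) (cap-rising x) (begin
      pos Δx A 0                 ≡⟨ cong (_+ pos Δx A 0) (Δx-cap x) ⟨
      Δx (cap x) + pos Δx A 0    ≡⟨ pos-++ Δx A [ cap x ] 0 ⟨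
      pos Δx (A ∷ʳ cap x) 0      ≡⟨ eX ⟩
      deg u                      ∎) eA ad
    = ∈-++⁺ˡ (∈-map⁺ (_∷ʳ cap x) (paths-complete u v adA))
  go : Rising s → A ++ s ∷ B ∈ paths u (x ∷ v)
  go U  = up U
  go U₂ = up U₂
  -- `D` moves right and the path ends at `deg u`, so `D` lies over a column of `u`, and some term
  -- of the coproduct cuts there.
  go D with t , t∈ , e ← find (Δᵂ-cuts u (≤-trans (pos-≤ Δx B _)
                           (≤-reflexive (trans (sym (pos-++ Δx A (D ∷ B) 0)) eX))))
    with split columns tail _ ← All.lookup (Δᵂ-splits u) t∈
    with adA , (_ , vB) , eXB , eYB ← Glue.unglue x v columns D e eA ad
    = ∈-++⁺ʳ (map (_∷ʳ cap x) (paths u v)) (∈-concatMap⁺ (pathsAt x v) (lose t∈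
        (∈-concatMap⁺ _ (lose (paths-complete _ v adA) (∈-map⁺ (λ Q → A ++ D ∷ Q)
          (tails-complete x B (axis-row x v) tail vB eXB (trans eYB (deg-∷ x v))))))))

-- The point and the step by which a path enters the last row are determined by the path,
-- so the paths of different summands of the recursion differ.
Enters : Word → Step → ℕ → Path → Set
Enters v s X S = ∃[ P ] ∃[ Q ] S ≡ P ++ s ∷ Q × pos Δx P 0 ≡ X × pos Δy P 0 ≡ deg v

Enters-unique : ∀ v {S} → Rising s → Rising t → Enters v s X S → Enters v t Y S → s ≡ t × X ≡ Y
Enters-unique v rs rt (P , Q , refl , eX , eY) (P′ , Q′ , e , eX′ , eY′)
  with refl , s≡t , _ ← crossing-unique P P′ rs rt e (trans eY (sym eY′)) = s≡t , trans (sym eX) eX′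

private
  pathsAt-enter : ∀ x v t → All (Enters v D (cut t)) (pathsAt x v t)
  pathsAt-enter x v (_ , a , b) = concatMap-All _ (All.map
    (λ {P} ad → All.map⁺ (All.universal
      (λ Q → P , Q , refl , Admissible.endsX ad , Admissible.endsY ad) (tails x b)))
    (paths-admissible a v))

  capped-enter : ∀ u x v → All (Enters v (cap x) (deg u)) (map (_∷ʳ cap x) (paths u v))
  capped-enter u x v = All.map⁺ (All.map
    (λ {P} ad → P , [] , refl , Admissible.endsX ad , Admissible.endsY ad) (paths-admissible u v))

  cap≢D : ∀ x → cap x ≢ D
  cap≢D 𝐜 ()
  cap≢D 𝐝 ()

paths-unique : ∀ u v → Unique (paths u v)
paths-unique u []      = [] ∷ []
paths-unique u (x ∷ v) = Unique.++⁺
  (Unique.map⁺ (∷ʳ-injectiveˡ _ _) (paths-unique u v))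
  (concatMap-unique (pathsAt x v)
    (All.universal (λ (_ , a , b) → concatMap-unique (joins b)
      (All.universal (λ P → Unique.map⁺ (∷-injectiveʳ ∘ ++-cancelˡ P _ _) (tails-unique x b)) _)
      (disjoint b (paths-admissible a v) (paths-unique a v))) (Δᵂ u))
    -- Different terms cut at different columns, and the cut is where the entering `D` starts.
    (AllPairs.map (λ {s} {t} ≢ {_} (p , q) → ≢ (proj₂ (Enters-unique v D D
        (All.lookup (pathsAt-enter x v s) p) (All.lookup (pathsAt-enter x v t) q))))
      (Δᵂ-cuts-distinct u)))
  -- Capped paths enter the last row by an upward step, the others by `D`.
  (λ (p , q) → cap≢D x (proj₁ (Enters-unique v (cap-rising x) D
    (All.lookup (capped-enter u x v) p)
    (proj₂ (All.lookup
      (concatMap-All {R = λ S → ∃[ X ] Enters v D X S} (pathsAt x v)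
        (All.universal (λ t → All.map (_ ,_) (pathsAt-enter x v t)) (Δᵂ u))) q)))))
  where
  joins : Word → Path → List Path
  joins b P = map (λ Q → P ++ D ∷ Q) (tails x b)
  disjoint : ∀ {a} b {Ps} → All (Admissible a v) Ps → Unique Ps →
             AllPairs (λ P P′ → Disjoint (joins b P) (joins b P′)) Ps
  disjoint b []         []       = []
  disjoint b (ad ∷ ads) (≢ ∷ un) =
    All.map (λ (ad′ , P≢P′) {_} (p , q) → P≢P′ (joins-disjoint ad ad′ p q)) (All.zip (ads , ≢)) ∷
    disjoint b ads un
    where
    joins-disjoint : ∀ {a P P′ S} → Admissible a v P → Admissible a v P′ →
                     S ∈ joins b P → S ∈ joins b P′ → P ≡ P′
    joins-disjoint {P = P} {P′} ad ad′ p q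
      with Q , _ , refl ← ∈-map⁻ _ p | Q′ , _ , e ← ∈-map⁻ _ q =
      proj₁ (crossing-unique P P′ D D e (trans (Admissible.endsY ad) (sym (Admissible.endsY ad′))))

-- Matching the terms of the diamond product with the paths.

infixl 7 _⊙_
_⊙_ : ℤ × Word → ℤ × Word → ℤ × Word
(j , a) ⊙ (k , b) = j ℤ.* k , a ++ b

*-⊙ : ∀ p q → p * q ≡ concatMap (λ s → map (s ⊙_) q) p
*-⊙ p q = concatMap-cong (λ s → scaled s q) p
  where
  scaled : ∀ s q → proj₁ s · extend (λ b → η (proj₂ s ++ b)) q ≡ map (s ⊙_) q
  scaled s []            = refl
  scaled s ((k , b) ∷ q) =
    cong₂ _∷_ (cong (λ i → proj₁ s ℤ.* i , proj₂ s ++ b) (ℤ.*-identityʳ k)) (scaled s q)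

*-letter : ∀ p x → p * letter x ≡ map (_⊙ (1ℤ , [ x ])) p
*-letter p x = trans (*-⊙ p (letter x))
  (trans (sym (concatMap-map [_] (_⊙ (1ℤ , [ x ])) p)) (concatMap-pure (map (_⊙ (1ℤ , [ x ])) p)))

tailPoly : Letter → Word → Poly
tailPoly 𝐜 b = η b
tailPoly 𝐝 b = Pyr (η b)

dia-∷ : ∀ u x v → dia u (x ∷ v) ≡
        dia u v * letter x ⊕ extend (λ (a , b) → dia a v * letter 𝐝 * tailPoly x b) (Δᵂ u)
dia-∷ u 𝐜 v = refl
dia-∷ u 𝐝 v = refl

1· : ∀ {A : Set} (p : Free A) → 1ℤ · p ≡ p
1· p = trans (map-cong (λ (k , x) → cong (_, x) (ℤ.*-identityˡ k)) p) (map-id p)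

extend-η : ∀ {A B : Set} (f : A → Free B) x → extend f (η x) ≡ f x
extend-η f x = trans (++-identityʳ _) (1· (f x))

letters : Path → Word
letters = map weightLetter

letters-rights : ∀ b → letters (rights b) ≡ b
letters-rights []      = refl
letters-rights (𝐜 ∷ b) = cong (𝐜 ∷_) (letters-rights b)
letters-rights (𝐝 ∷ b) = cong (𝐝 ∷_) (letters-rights b)

unit : Path → ℤ × Word
unit Q = 1ℤ , letters Q

-- Replacing one `R` by `D` is the rule `𝐜` to `𝐝`, and replacing one `R₂` by `R` and `D` is the
-- rule `𝐝` to `𝐜𝐝`.
Gᵂ-rightsWithD : ∀ b → Gᵂ b ≡ map unit (rightsWithD b)
Gᵂ-rightsWithD []      = refl
Gᵂ-rightsWithD (𝐜 ∷ b) = cong₂ _∷_ (cong (λ a → 1ℤ , 𝐝 ∷ a) (sym (letters-rights b)))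
  (trans (cong ([ 𝐜 ] ◃_) (Gᵂ-rightsWithD b))
    (trans (sym (map-∘ (rightsWithD b))) (map-∘ (rightsWithD b))))
Gᵂ-rightsWithD (𝐝 ∷ b) = cong₂ _∷_ (cong (λ a → 1ℤ , 𝐜 ∷ 𝐝 ∷ a) (sym (letters-rights b)))
  (trans (cong ([ 𝐝 ] ◃_) (Gᵂ-rightsWithD b))
    (trans (sym (map-∘ (rightsWithD b))) (map-∘ (rightsWithD b))))

tailPoly-tails : ∀ x b → tailPoly x b ≡ map unit (tails x b)
tailPoly-tails 𝐜 b = cong η (sym (letters-rights b))
tailPoly-tails 𝐝 b = cong₂ _++_
  (trans (*-letter (η b) 𝐜) (cong (λ a → [ 1ℤ , a ]) (begin
    b ∷ʳ 𝐜                       ≡⟨ cong (_∷ʳ 𝐜) (letters-rights b) ⟨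
    letters (rights b) ∷ʳ 𝐜      ≡⟨ map-++ weightLetter (rights b) [ U ] ⟨
    letters (rights b ∷ʳ U)      ∎)))
  (trans (extend-η Gᵂ b) (Gᵂ-rightsWithD b))
  where open ≡-Reasoning

term : Word → Word → Path → ℤ × Word
term u v P = multOf u v P , letters P

concatMap-cong-local : {A B : Set} {f g : A → List B} {xs : List A} →
                       All (λ x → f x ≡ g x) xs → concatMap f xs ≡ concatMap g xs
concatMap-cong-local = cong concat ∘ map-cong-local

-- `paths` copies the recursion of `dia`, so both sides list their terms in the same order. They are
-- equal as lists, without collecting terms.
dia-paths : ∀ u v → dia u v ≡ map (term u v) (paths u v)
dia-paths u []      = cong₂ (λ k a → [ k , a ])
  (sym (Runs.mult≡1 (rights-runs {w = axis []} {y = 0} (Tail-part u)))) (sym (letters-rights u))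
dia-paths u (x ∷ v) = begin
  dia u (x ∷ v)
    ≡⟨ dia-∷ u x v ⟩
  dia u v * letter x ⊕ extend (λ (a , b) → dia a v * letter 𝐝 * tailPoly x b) (Δᵂ u)
    ≡⟨ cong₂ _++_ capped-terms (concatMap-cong-local (All.map joined-terms (Δᵂ-splits u))) ⟩
  map (term u (x ∷ v)) (map (_∷ʳ cap x) (paths u v)) ++
  concatMap (map (term u (x ∷ v)) ∘ pathsAt x v) (Δᵂ u)
    ≡⟨ cong (map (term u (x ∷ v)) (map (_∷ʳ cap x) (paths u v)) ++_) (map-concatMap (term u (x ∷ v)) (pathsAt x v) (Δᵂ u)) ⟨
  map (term u (x ∷ v)) (map (_∷ʳ cap x) (paths u v)) ++
  map (term u (x ∷ v)) (concatMap (pathsAt x v) (Δᵂ u))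
    ≡⟨ map-++ (term u (x ∷ v)) (map (_∷ʳ cap x) (paths u v)) _ ⟨
  map (term u (x ∷ v)) (paths u (x ∷ v)) ∎
  where
  open ≡-Reasoning
  capped-terms : dia u v * letter x ≡ map (term u (x ∷ v)) (map (_∷ʳ cap x) (paths u v))
  capped-terms = begin
    dia u v * letter x
      ≡⟨ *-letter (dia u v) x ⟩
    map (_⊙ (1ℤ , [ x ])) (dia u v)
      ≡⟨ cong (map (_⊙ (1ℤ , [ x ]))) (dia-paths u v) ⟩
    map (_⊙ (1ℤ , [ x ])) (map (term u v) (paths u v))
      ≡⟨ map-∘ (paths u v) ⟨
    map (λ P → term u v P ⊙ (1ℤ , [ x ])) (paths u v)
      ≡⟨ map-cong-local (All.map capped-term (paths-admissible u v)) ⟩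
    map (λ P → term u (x ∷ v) (P ∷ʳ cap x)) (paths u v)
      ≡⟨ map-∘ (paths u v) ⟩
    map (term u (x ∷ v)) (map (_∷ʳ cap x) (paths u v)) ∎
    where
    capped-term : ∀ {P} → Admissible u v P → term u v P ⊙ (1ℤ , [ x ]) ≡ term u (x ∷ v) (P ∷ʳ cap x)
    capped-term {P} ad = cong₂ _,_
      (trans (ℤ.*-identityʳ _) (sym (proj₂ (capped u x v ad))))
      (trans (cong (λ y → letters P ∷ʳ y) (sym (weightLetter-cap x)))
             (sym (map-++ weightLetter P [ cap x ])))
  joined-terms : ∀ {t} → Split u t → let k , a , b = t in
    k · (dia a v * letter 𝐝 * tailPoly x b) ≡ map (term u (x ∷ v)) (pathsAt x v t)
  joined-terms {k , a , b} sp = begin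
    k · (dia a v * letter 𝐝 * tailPoly x b)
      ≡⟨ cong (k ·_) (trans (*-⊙ (dia a v * letter 𝐝) _)
           (cong₂ (λ p q → concatMap (λ s → map (s ⊙_) q) p) prefix (tailPoly-tails x b))) ⟩
    k · concatMap (λ s → map (s ⊙_) (map unit (tails x b))) (map (λ P → term a v P ⊙ (1ℤ , [ 𝐝 ])) (paths a v))
      ≡⟨ cong (k ·_) (concatMap-map _ _ (paths a v)) ⟩
    k · concatMap (λ P → map (term a v P ⊙ (1ℤ , [ 𝐝 ]) ⊙_) (map unit (tails x b))) (paths a v)
      ≡⟨ map-concatMap _ _ (paths a v) ⟩
    concatMap (λ P → k · map (term a v P ⊙ (1ℤ , [ 𝐝 ]) ⊙_) (map unit (tails x b))) (paths a v)
      ≡⟨ concatMap-cong-local (All.map joined-row (paths-admissible a v)) ⟩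
    concatMap (map (term u (x ∷ v)) ∘ λ P → map (λ Q → P ++ D ∷ Q) (tails x b)) (paths a v)
      ≡⟨ map-concatMap (term u (x ∷ v)) _ (paths a v) ⟨
    map (term u (x ∷ v)) (pathsAt x v (k , a , b)) ∎
    where
    prefix : dia a v * letter 𝐝 ≡ map (λ P → term a v P ⊙ (1ℤ , [ 𝐝 ])) (paths a v)
    prefix = trans (*-letter (dia a v) 𝐝)
      (trans (cong (map (_⊙ (1ℤ , [ 𝐝 ]))) (dia-paths a v)) (sym (map-∘ (paths a v))))
    -- The two factors `1ℤ` come from the letter `𝐝` and from the tail. `extend` puts `k` on the
    -- left, whereas along the path it comes after the factors of `P`.
    joined-term : ∀ P Q → multOf u (x ∷ v) (P ++ D ∷ Q) ≡ multOf a v P ℤ.* k →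
      (k ℤ.* (multOf a v P ℤ.* 1ℤ ℤ.* 1ℤ) , (letters P ++ [ 𝐝 ]) ++ letters Q) ≡ term u (x ∷ v) (P ++ D ∷ Q)
    joined-term P Q e = cong₂ _,_
      (begin
        k ℤ.* (multOf a v P ℤ.* 1ℤ ℤ.* 1ℤ)
          ≡⟨ cong (k ℤ.*_) (trans (ℤ.*-identityʳ _) (ℤ.*-identityʳ _)) ⟩
        k ℤ.* multOf a v P
          ≡⟨ ℤ.*-comm k _ ⟩
        multOf a v P ℤ.* k
          ≡⟨ e ⟨
        multOf u (x ∷ v) (P ++ D ∷ Q) ∎)
      (trans (++-assoc (letters P) [ 𝐝 ] (letters Q)) (sym (map-++ weightLetter P (D ∷ Q))))
    joined-row : ∀ {P} → Admissible a v P →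
      k · map (term a v P ⊙ (1ℤ , [ 𝐝 ]) ⊙_) (map unit (tails x b)) ≡
      map (term u (x ∷ v)) (map (λ Q → P ++ D ∷ Q) (tails x b))
    joined-row {P} ad =
      trans (sym (trans (map-∘ (tails x b)) (map-∘ (map unit (tails x b)))))
        (trans (map-cong-local (All.map (λ {Q} (_ , e) → joined-term P Q e) (joined x v sp ad)))
          (map-∘ (tails x b)))

-- Weights of the listed paths, and the final assembly.

∑-wt : ∀ u v Ps → ∑ (map (wt u v) Ps) ≡
       map (λ P → mult (part u) (part v) 0 0 P nothing , letters P) Ps
∑-wt u v Ps = trans (cong ∑ (map-cong (wtFrom-monomial u v 0 0) Ps))
  (trans (cong concat (map-∘ Ps)) (concatMap-pure _))

theorem5p4 : (u v : Word) →
    ∃[ Ps ] Unique Ps × (∀ P → (P ∈ Ps) ⇔ Γ u v P) × (η u ⋄ η v ≈ ∑ (map (wt u v) Ps))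
theorem5p4 u v = Ps , paths-unique u (reverse v) , (λ P → mk⇔ sound complete) ,
  -- The two polynomials are the same list of terms, hence have the same coefficients.
  (λ w → cong (coeff w) (begin
    η u ⋄ η v
      ≡⟨ extend-η (λ u → extend (λ v → u ⋄ᵂ v) (η v)) u ⟩
    extend (λ v → u ⋄ᵂ v) (η v)
      ≡⟨ extend-η (λ v → u ⋄ᵂ v) v ⟩
    dia u (reverse v)
      ≡⟨ dia-paths u (reverse v) ⟩
    map (term u (reverse v)) Ps
      ≡⟨ cong (λ v → map (λ P → mult (part u) (part v) 0 0 P nothing , letters P) Ps) (reverse-involutive v) ⟩
    map (λ P → mult (part u) (part v) 0 0 P nothing , letters P) Ps
      ≡⟨ ∑-wt u v Ps ⟨
    ∑ (map (wt u v) Ps) ∎))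
  where
  open ≡-Reasoning
  Ps = paths u (reverse v)
  sound : ∀ {P} → P ∈ Ps → Γ u v P
  sound {P} P∈ with admissible valid eX eY ← All.lookup (paths-admissible u (reverse v)) P∈ =
    Valid⇒Γ u v (trans (sym (pos-0 Δx P)) eX) (trans (sym (pos-0 Δy P)) (trans eY (deg-reverse v)))
      (subst (λ v → Valid (part u) (part v) 0 0 P nothing) (reverse-involutive v) valid)
  complete : ∀ {P} → Γ u v P → P ∈ Ps
  complete {P} γ = paths-complete u (reverse v) (admissible
    (subst (λ v → Valid (part u) (part v) 0 0 P nothing) (sym (reverse-involutive v)) (Γ⇒Valid u v γ))
    (trans (pos-0 Δx P) endX≡p) (trans (pos-0 Δy P) (trans endY≡q (sym (deg-reverse v)))))
    where
    open Γ γ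
    open Γ₀ lattice
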